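{- There is a polynomial-time algorithm that, given an instance of SD-3-RSND with $2$-edge-connected input graph $G=(V,E)$ and demand pair $s,t$, computes a set $D$ of ordinary $3$-demands (i.e. a set of pairs $\{u,v\}\subseteq V$ with $\lambda_G(u,v)\ge 3$) such that for every $H\subseteq E$ that contains all forced edges, $H$ is a feasible solution of the SD-3-RSND instance if and only if $H$ satisfies all demands in $D$ (i.e. $\lambda_H(u,v)\ge 3$ for every $\{u,v\}\in D$).
   Context: Graphs are finite, undirected, and may have parallel edges. An edge set $H\subseteq E$ is identified with the spanning subgraph $(V,H)$. $\lambda_G(u,v)$ denotes the minimum size of an edge cut of $G$ separating $u$ and $v$. In SD-3-RSND the input is a graph $G=(V,E)$ with nonnegative edge weights and a pair $s,t\in V$; a subgraph $H$ is feasible if for every $F\subseteq E$ with $|F|\le 2$, existence of an $st$-path in $G\setminus F$ implies existence of an $st$-path in $H\setminus F$. For $A\subseteq V$, $\delta_G(A)$ is the set of edges of $G$ with exactly one endpoint in $A$; an $st$-cut is a set $\delta_G(A)$ with $s\in A$, $t\notin A$. The forced edges are the edges that belong to some $st$-cut of $G$ of size $2$. -}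

module Defs where

open import Data.Bool.Base using (Bool; true; false; if_then_else_; _xor_)
open import Data.Fin.Base using (Fin; toℕ)
open import Data.Fin.Subset using (Subset; inside; outside; _∈_; _∉_; _∩_; _─_; ∣_∣; ⊤)
open import Data.Fin.Subset.Properties using (_∈?_)
open import Data.Integer.Base as ℤ using ()
open import Data.List.Base as List using (List; []; _∷_; _++_)
open import Data.List.Extrema.Nat using (min)
open import Data.List.Membership.Propositional using () renaming (_∈_ to _∈ᴸ_)
open import Data.List.Relation.Unary.All as All using (All; []; _∷_)
open import Data.Nat.Base using (ℕ; zero; suc; _+_; _≤_)
open import Data.Nat.Binary.Base using (ℕᵇ; zero; 2[1+_]; 1+[2_]; fromℕ)
open import Data.Product.Base using (Σ-syntax; _×_; _,_; proj₁; proj₂)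
open import Data.Rational.Base as ℚ using (ℚ; 0ℚ; ↥_; ↧ₙ_)
open import Data.Sum.Base using (_⊎_)
open import Data.Vec.Base as Vec using (Vec)
open import Relation.Binary.Construct.Closure.ReflexiveTransitive using (Star)
open import Relation.Binary.PropositionalEquality using (_≡_; _≢_)
open import Relation.Nullary.Decidable using (_×-dec_; ¬?)

------------------------------------------------------------------------
-- Graphs

-- Edges carry identities, so parallel edges are allowed.  The orientation
-- of the pair `ends e` is never used.

record Graph : Set where
  field
    n m  : ℕ
    ends : Fin m → Fin n × Fin n

  V E : Set
  V = Fin n
  E = Fin m

  VertexSet EdgeSet : Set
  VertexSet = Subset n
  EdgeSet   = Subset m

-- All subsets of Fin n, each listed once.

subsets : ∀ n → List (Subset n)
subsets zero    = Vec.[] ∷ []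
subsets (suc n) = List.map (inside Vec.∷_) (subsets n) ++ List.map (outside Vec.∷_) (subsets n)

module _ (G : Graph) where
  open Graph G

  -- An edge set H stands for the spanning subgraph (V , H), so G itself is ⊤.

  Adjacent : EdgeSet → V → V → Set
  Adjacent H u v = Σ[ e ∈ E ] e ∈ H × (ends e ≡ (u , v) ⊎ ends e ≡ (v , u))

  HasPath : EdgeSet → V → V → Set
  HasPath H = Star (Adjacent H)

  δ : EdgeSet → VertexSet → EdgeSet
  δ H A = H ∩ Vec.tabulate λ e →
    Vec.lookup A (proj₁ (ends e)) xor Vec.lookup A (proj₂ (ends e))

  separating : V → V → List VertexSet
  separating u v = List.filter (λ A → (u ∈? A) ×-dec ¬? (v ∈? A)) (subsets n)

  -- Minimum size of a cut of (V , H) separating u and v.  For u ≢ v the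
  -- initial value ∣ H ∣ is an upper bound on the size of any cut and so
  -- does not affect the minimum; for u ≡ v the value is meaningless.

  edgeConnectivity : EdgeSet → V → V → ℕ
  edgeConnectivity H u v = min ∣ H ∣ (List.map (λ A → ∣ δ H A ∣) (separating u v))

  TwoEdgeConnected : Set
  TwoEdgeConnected = ∀ (F : EdgeSet) → ∣ F ∣ ≤ 1 → ∀ u v → HasPath (⊤ ─ F) u v

-- H satisfies the ordinary 3-demand {u , v}.

Satisfies : (G : Graph) → Graph.EdgeSet G → Graph.V G × Graph.V G → Set
Satisfies G H (u , v) = 3 ≤ edgeConnectivity G H u v

IsOrdinary3Demand : (G : Graph) → Graph.V G × Graph.V G → Set
IsOrdinary3Demand G (u , v) = u ≢ v × 3 ≤ edgeConnectivity G ⊤ u v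

------------------------------------------------------------------------
-- SD-3-RSND

record Instance : Set where
  field
    graph     : Graph
  open Graph graph public
  field
    weight    : E → ℚ
    weight≥0  : ∀ e → 0ℚ ℚ.≤ weight e
    s t       : V

module _ (I : Instance) where
  open Instance I

  Feasible : EdgeSet → Set
  Feasible H = ∀ (F : EdgeSet) → ∣ F ∣ ≤ 2 →
    HasPath graph (⊤ ─ F) s t → HasPath graph (H ─ F) s t

  Forced : E → Set
  Forced e = Σ[ A ∈ VertexSet ]
    s ∈ A × t ∉ A × ∣ δ graph ⊤ A ∣ ≡ 2 × e ∈ δ graph ⊤ A

------------------------------------------------------------------------
-- Algorithms

-- The model of computation is a first-order language with data built from
-- booleans, unary naturals, pairs and lists, and with primitive recursion
-- on naturals and lists.  A step is charged for every construct executed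
-- and for every unrolling of a recursion.  A step is O(1) work on a machine
-- with pointers (values are never copied), so a polynomially bounded cost
-- gives polynomial time on a Turing machine; conversely, nested recursion
-- supplies a clock of any polynomial length, so every polynomial-time
-- Turing machine can be simulated at polynomial cost.

data Ty : Set where
  bool nat : Ty
  _⊗_      : Ty → Ty → Ty
  list     : Ty → Ty

infixr 6 _⊗_

⟦_⟧ : Ty → Set
⟦ bool ⟧   = Bool
⟦ nat ⟧    = ℕ
⟦ σ ⊗ τ ⟧  = ⟦ σ ⟧ × ⟦ τ ⟧
⟦ list τ ⟧ = List ⟦ τ ⟧

size : ∀ τ → ⟦ τ ⟧ → ℕ
size bool     _        = 1
size nat      k        = suc k
size (σ ⊗ τ)  (x , y)  = suc (size σ x + size τ y)
size (list τ) []       = 1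
size (list τ) (x ∷ xs) = suc (size τ x + size (list τ) xs)

Ctx : Set
Ctx = List Ty

Env : Ctx → Set
Env = All ⟦_⟧

-- In the recursors the branch for `suc k` sees k and the result for k;
-- the branch for `x ∷ xs` sees x, xs and the result for xs.

data Tm (Γ : Ctx) : Ty → Set where
  var         : ∀ {τ} → τ ∈ᴸ Γ → Tm Γ τ
  let′        : ∀ {σ τ} → Tm Γ σ → Tm (σ ∷ Γ) τ → Tm Γ τ
  true′ false′ : Tm Γ bool
  if′         : ∀ {τ} → Tm Γ bool → Tm Γ τ → Tm Γ τ → Tm Γ τ
  zero′       : Tm Γ nat
  suc′        : Tm Γ nat → Tm Γ nat
  natrec′     : ∀ {τ} → Tm Γ nat → Tm Γ τ → Tm (nat ∷ τ ∷ Γ) τ → Tm Γ τ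
  pair′       : ∀ {σ τ} → Tm Γ σ → Tm Γ τ → Tm Γ (σ ⊗ τ)
  fst′        : ∀ {σ τ} → Tm Γ (σ ⊗ τ) → Tm Γ σ
  snd′        : ∀ {σ τ} → Tm Γ (σ ⊗ τ) → Tm Γ τ
  nil′        : ∀ {τ} → Tm Γ (list τ)
  cons′       : ∀ {τ} → Tm Γ τ → Tm Γ (list τ) → Tm Γ (list τ)
  listrec′    : ∀ {σ τ} → Tm Γ (list σ) → Tm Γ τ → Tm (σ ∷ list σ ∷ τ ∷ Γ) τ → Tm Γ τ

natRec : {A : Set} → A → (ℕ → A → A) → ℕ → A
natRec z f zero    = z
natRec z f (suc k) = f k (natRec z f k)

listRec : {A B : Set} → B → (A → List A → B → B) → List A → B
listRec z f []       = z
listRec z f (x ∷ xs) = f x xs (listRec z f xs)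

-- Total cost of the unrolled recursion, given the cost c of each unrolling.

natRecCost : {A : Set} → A → (ℕ → A → A) → (ℕ → A → ℕ) → ℕ → ℕ
natRecCost z f c zero    = 0
natRecCost z f c (suc k) = suc (c k (natRec z f k)) + natRecCost z f c k

listRecCost : {A B : Set} → B → (A → List A → B → B) → (A → List A → B → ℕ) → List A → ℕ
listRecCost z f c []       = 0
listRecCost z f c (x ∷ xs) = suc (c x xs (listRec z f xs)) + listRecCost z f c xs

eval : ∀ {Γ τ} → Tm Γ τ → Env Γ → ⟦ τ ⟧
eval (var i)          ρ = All.lookup ρ i
eval (let′ a b)       ρ = eval b (eval a ρ ∷ ρ)
eval true′            ρ = true
eval false′           ρ = false
eval (if′ a b c)      ρ = if eval a ρ then eval b ρ else eval c ρ
eval zero′            ρ = zero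
eval (suc′ a)         ρ = suc (eval a ρ)
eval (natrec′ a z f)  ρ = natRec (eval z ρ) (λ k r → eval f (k ∷ r ∷ ρ)) (eval a ρ)
eval (pair′ a b)      ρ = eval a ρ , eval b ρ
eval (fst′ a)         ρ = proj₁ (eval a ρ)
eval (snd′ a)         ρ = proj₂ (eval a ρ)
eval nil′             ρ = []
eval (cons′ a b)      ρ = eval a ρ ∷ eval b ρ
eval (listrec′ a z f) ρ =
  listRec (eval z ρ) (λ x xs r → eval f (x ∷ xs ∷ r ∷ ρ)) (eval a ρ)

cost : ∀ {Γ τ} → Tm Γ τ → Env Γ → ℕ
cost (var i)          ρ = 1
cost (let′ a b)       ρ = suc (cost a ρ + cost b (eval a ρ ∷ ρ))
cost true′            ρ = 1
cost false′           ρ = 1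
cost (if′ a b c)      ρ = suc (cost a ρ + (if eval a ρ then cost b ρ else cost c ρ))
cost zero′            ρ = 1
cost (suc′ a)         ρ = suc (cost a ρ)
cost (natrec′ a z f)  ρ = suc (cost a ρ + cost z ρ +
  natRecCost (eval z ρ) (λ k r → eval f (k ∷ r ∷ ρ))
             (λ k r → cost f (k ∷ r ∷ ρ)) (eval a ρ))
cost (pair′ a b)      ρ = suc (cost a ρ + cost b ρ)
cost (fst′ a)         ρ = suc (cost a ρ)
cost (snd′ a)         ρ = suc (cost a ρ)
cost nil′             ρ = 1
cost (cons′ a b)      ρ = suc (cost a ρ + cost b ρ)
cost (listrec′ a z f) ρ = suc (cost a ρ + cost z ρ +
  listRecCost (eval z ρ) (λ x xs r → eval f (x ∷ xs ∷ r ∷ ρ))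
              (λ x xs r → cost f (x ∷ xs ∷ r ∷ ρ)) (eval a ρ))

Program : Ty → Ty → Set
Program σ τ = Tm (σ ∷ []) τ

run : ∀ {σ τ} → Program σ τ → ⟦ σ ⟧ → ⟦ τ ⟧
run P x = eval P (x ∷ [])

time : ∀ {σ τ} → Program σ τ → ⟦ σ ⟧ → ℕ
time P x = cost P (x ∷ [])

------------------------------------------------------------------------
-- Encoding of instances

-- Bijective binary numeration, least significant digit first.

bits : ℕᵇ → List Bool
bits zero     = []
bits 2[1+ x ] = true ∷ bits x
bits 1+[2 x ] = false ∷ bits x

pairTy vertexPairsTy weightTy instanceTy : Ty
pairTy        = nat ⊗ nat
vertexPairsTy = list pairTy
weightTy      = list bool ⊗ list bool
instanceTy    = nat ⊗ vertexPairsTy ⊗ list weightTy ⊗ nat ⊗ nat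

encodePair : ∀ {n} → Fin n × Fin n → ⟦ pairTy ⟧
encodePair (u , v) = toℕ u , toℕ v

-- Numerator and denominator in binary; the sign is dropped because weights
-- are nonnegative.

encodeWeight : ℚ → ⟦ weightTy ⟧
encodeWeight q = bits (fromℕ ℤ.∣ ↥ q ∣) , bits (fromℕ (↧ₙ q))

encode : Instance → ⟦ instanceTy ⟧
encode I =
  n ,
  List.tabulate (λ e → encodePair (ends e)) ,
  List.tabulate (λ e → encodeWeight (weight e)) ,
  toℕ s , toℕ t
  where open Instance I

{-# OPTIONS --safe #-}

-- An edge e is forced iff s and t are disconnected in G - {e , f} for some edge f.  Call s, t and
-- the ends of forced edges terminals; the demands are the pairs of distinct terminals that are
-- connected by unforced edges.
--
-- Let H ⊇ forced edges be feasible and S a cut of H of size at most 2.  If S separates s from t,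
-- then by feasibility δ_H(S) is a 2-cut of G, so it consists of forced edges, and it does not split
-- linked terminals.  If S does not separate s from t and splits the linked terminals w and z, then
-- uncrossing S with the 2-cut through a forced edge at w gives two st-cuts of H, of total size at
-- most 4, one of which splits w and z, contradicting the first case.  Conversely, if H satisfies
-- the demands, then a cut of size at most 2 of H does not split linked terminals, and so it
-- contains an st-cut of G if it separates s from t.
--
-- Connectivity is decided by merging vertex labels along the edges.

module Submission where

open import Defs
open import Algebra.Properties.CommutativeSemigroup using (interchange)
open import Data.Bool.Base using (Bool; true; false; if_then_else_; not; _∧_; _∨_; _xor_; T)
open import Data.Bool.Properties as Bool using ()
open import Data.Empty as Empty using ()
open import Data.Fin.Base as Fin using (Fin; zero; suc; toℕ; opposite)
open import Data.Fin.Properties as Fin using (any?; toℕ<n; toℕ-inject₁; toℕ-fromℕ; opposite-involutive)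
open import Data.Fin.Subset using (Subset; inside; outside; _∈_; _∉_; _⊆_; _─_; _-_; ∣_∣; ⊤; ⊥; ⁅_⁆)
open import Data.Fin.Subset.Properties using (_∈?_; ∈⊤; ∣⊥∣≡0; ∣p∣≤∣x∷p∣; ∣⁅x⁆∣≡1; x∈⁅x⁆; x∈⁅y⁆⇒x≡y; p⊆q⇒∣p∣≤∣q∣; p⊂q⇒∣p∣<∣q∣; x∈p∧x∉q⇒x∈p─q; p─q⊆p; x∈p∧x≢y⇒x∈p-y; x∈p⇒∣p-x∣<∣p∣; ∣p∩q∣≤∣p∣)
open import Data.List.Base using (List; []; _∷_; length; map; tabulate)
open import Data.List.Extrema.Nat using (v<min⁺; min≤xs)
open import Data.List.Membership.Propositional using () renaming (_∈_ to _∈ᴸ_)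
open import Data.List.Membership.Propositional.Properties using (∈-map⁺; ∈-++⁺ˡ; ∈-++⁺ʳ; ∈-filter⁺)
open import Data.List.Properties using (map-tabulate; tabulate-cong; length-tabulate; length-map)
open import Data.List.Relation.Unary.All as All using (All; []; _∷_)
open import Data.List.Relation.Unary.All.Properties as All using (all-filter)
open import Data.List.Relation.Unary.Any using (here; there)
open import Data.Nat.Base hiding (∣_-_∣)
open import Data.Nat.Properties
open import Data.Product.Base using (Σ-syntax; ∃-syntax; _×_; _,_; proj₁; proj₂)
open import Data.Sum.Base as Sum using (_⊎_; inj₁; inj₂)
open import Data.Unit.Base using (tt) renaming (⊤ to Unit)
open import Data.Vec.Base as Vec using ([]; _∷_; lookup)
open import Data.Vec.Properties as Vec using ([]=⇒lookup; lookup⇒[]=; lookup∘tabulate; lookup-zipWith; tabulate∘lookup)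
open import Function.Base using (_∘_)
open import Function.Bundles using (mk⇔; _⇔_)
open import Relation.Binary.Construct.Closure.ReflexiveTransitive as Star using (Star; ε; _◅_; _◅◅_)
open import Relation.Binary.PropositionalEquality
open import Relation.Nullary.Decidable using (Dec; yes; no; does; map′; ¬?; _×-dec_; dec-true; dec-false; does-⇔)
open import Relation.Nullary.Negation using (¬_; contradiction)


-- The cost of a program

-- Demands between all vertices joined by unforced edges would be too strong: a vertex of degree 2
-- may hang on such edges, cut off from `s` and `t` by two edges, and no demand at it is ordinary. A
-- terminal other than `s` and `t` is protected from this by a forced edge that ends at it: in the
-- uncrossing, this edge does not run between the two parts outside the small cut, which leaves at
-- most one edge of the 2-cut there, and 2 + 2 * 1 = 4 falls short of 3 + 2. The vertices `s` and
-- `t` join the terminals so that a path from `s` to `t` begins and ends at one. For the running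
-- time, a program whose recursions all unroll at most `N` times has cost polynomial in `N`, with an
-- exponent read off its syntax. So only lengths and magnitudes need bounds, and those of the
-- computed labels and terminals come from the evaluation lemmas.

NatRecAll : {A : Set} → A → (ℕ → A → A) → (ℕ → A → Set) → ℕ → Set
NatRecAll z f P zero    = Unit
NatRecAll z f P (suc k) = P k (natRec z f k) × NatRecAll z f P k

ListRecAll : {A B : Set} → B → (A → List A → B → B) → (A → List A → B → Set) → List A → Set
ListRecAll z f P []       = Unit
ListRecAll z f P (x ∷ xs) = P x xs (listRec z f xs) × ListRecAll z f P xs

-- Every recursion executed by t under ρ unrolls at most N times.

Small : ∀ {Γ τ} → ℕ → Tm Γ τ → Env Γ → Set
Small N (var i)          ρ = Unit
Small N (let′ a b)       ρ = Small N a ρ × Small N b (eval a ρ ∷ ρ)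
Small N true′            ρ = Unit
Small N false′           ρ = Unit
Small N (if′ a b c)      ρ = Small N a ρ × Small N b ρ × Small N c ρ
Small N zero′            ρ = Unit
Small N (suc′ a)         ρ = Small N a ρ
Small N (natrec′ a z f)  ρ = Small N a ρ × Small N z ρ × eval a ρ ≤ N ×
  NatRecAll (eval z ρ) (λ k r → eval f (k ∷ r ∷ ρ)) (λ k r → Small N f (k ∷ r ∷ ρ)) (eval a ρ)
Small N (pair′ a b)      ρ = Small N a ρ × Small N b ρ
Small N (fst′ a)         ρ = Small N a ρ
Small N (snd′ a)         ρ = Small N a ρ
Small N nil′             ρ = Unit
Small N (cons′ a b)      ρ = Small N a ρ × Small N b ρ
Small N (listrec′ a z f) ρ = Small N a ρ × Small N z ρ × length (eval a ρ) ≤ N ×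
  ListRecAll (eval z ρ) (λ x xs r → eval f (x ∷ xs ∷ r ∷ ρ))
             (λ x xs r → Small N f (x ∷ xs ∷ r ∷ ρ)) (eval a ρ)

-- Both branches of a conditional and `N` unrollings of every recursion are charged, so that the
-- environment drops out.
costBound : ∀ {Γ τ} → Tm Γ τ → ℕ → ℕ
costBound (var i)          N = 1
costBound (let′ a b)       N = suc (costBound a N + costBound b N)
costBound true′            N = 1
costBound false′           N = 1
costBound (if′ a b c)      N = suc (costBound a N + (costBound b N + costBound c N))
costBound zero′            N = 1
costBound (suc′ a)         N = suc (costBound a N)
costBound (natrec′ a z f)  N = suc (costBound a N + costBound z N + N * suc (costBound f N))
costBound (pair′ a b)      N = suc (costBound a N + costBound b N)
costBound (fst′ a)         N = suc (costBound a N)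
costBound (snd′ a)         N = suc (costBound a N)
costBound nil′             N = 1
costBound (cons′ a b)      N = suc (costBound a N + costBound b N)
costBound (listrec′ a z f) N = suc (costBound a N + costBound z N + N * suc (costBound f N))

module _ {A : Set} {z : A} {f : ℕ → A → A} {c : ℕ → A → ℕ} {P : ℕ → A → Set} {C : ℕ} where

  natRecCost-≤ : (∀ k r → P k r → c k r ≤ C) → ∀ k → NatRecAll z f P k →
                 natRecCost z f c k ≤ k * suc C
  natRecCost-≤ c≤ zero    _        = z≤n
  natRecCost-≤ c≤ (suc k) (p , ps) = +-mono-≤ (s≤s (c≤ _ _ p)) (natRecCost-≤ c≤ k ps)

module _ {A B : Set} {z : B} {f : A → List A → B → B} {c : A → List A → B → ℕ}
         {P : A → List A → B → Set} {C : ℕ} where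

  listRecCost-≤ : (∀ x xs r → P x xs r → c x xs r ≤ C) → ∀ xs → ListRecAll z f P xs →
                  listRecCost z f c xs ≤ length xs * suc C
  listRecCost-≤ c≤ []       _        = z≤n
  listRecCost-≤ c≤ (x ∷ xs) (p , ps) = +-mono-≤ (s≤s (c≤ _ _ _ p)) (listRecCost-≤ c≤ xs ps)

if-≤ : ∀ b {x y x′ y′} → x ≤ x′ → y ≤ y′ → (if b then x else y) ≤ x′ + y′
if-≤ true  {x′ = x′} p q = ≤-trans p (m≤m+n x′ _)
if-≤ false {y′ = y′} p q = ≤-trans q (m≤n+m y′ _)

cost≤costBound : ∀ {Γ τ} (t : Tm Γ τ) {N} (ρ : Env Γ) → Small N t ρ → cost t ρ ≤ costBound t N
cost≤costBound (var i)    ρ _ = ≤-refl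
cost≤costBound (let′ a b) ρ (sa , sb) =
  s≤s (+-mono-≤ (cost≤costBound a ρ sa) (cost≤costBound b _ sb))
cost≤costBound true′  ρ _ = ≤-refl
cost≤costBound false′ ρ _ = ≤-refl
cost≤costBound (if′ a b c) ρ (sa , sb , sc) =
  s≤s (+-mono-≤ (cost≤costBound a ρ sa)
                (if-≤ (eval a ρ) (cost≤costBound b ρ sb) (cost≤costBound c ρ sc)))
cost≤costBound zero′    ρ _  = ≤-refl
cost≤costBound (suc′ a) ρ sa = s≤s (cost≤costBound a ρ sa)
cost≤costBound (natrec′ a z f) ρ (sa , sz , k≤N , sf) =
  s≤s (+-mono-≤ (+-mono-≤ (cost≤costBound a ρ sa) (cost≤costBound z ρ sz))
    (≤-trans (natRecCost-≤ (λ _ _ → cost≤costBound f _) (eval a ρ) sf)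
             (*-monoˡ-≤ _ k≤N)))
cost≤costBound (pair′ a b) ρ (sa , sb) =
  s≤s (+-mono-≤ (cost≤costBound a ρ sa) (cost≤costBound b ρ sb))
cost≤costBound (fst′ a) ρ sa = s≤s (cost≤costBound a ρ sa)
cost≤costBound (snd′ a) ρ sa = s≤s (cost≤costBound a ρ sa)
cost≤costBound nil′     ρ _  = ≤-refl
cost≤costBound (cons′ a b) ρ (sa , sb) =
  s≤s (+-mono-≤ (cost≤costBound a ρ sa) (cost≤costBound b ρ sb))
cost≤costBound (listrec′ a z f) ρ (sa , sz , l≤N , sf) =
  s≤s (+-mono-≤ (+-mono-≤ (cost≤costBound a ρ sa) (cost≤costBound z ρ sz))
    (≤-trans (listRecCost-≤ (λ _ _ _ → cost≤costBound f _) (eval a ρ) sf)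
             (*-monoˡ-≤ _ l≤N)))

-- The exponents add up as in `costBound-≼`: one more for each sum, and one for the factor `N` of a
-- recursion.
degree : ∀ {Γ τ} → Tm Γ τ → ℕ
degree (var i)          = 0
degree (let′ a b)       = suc (suc (degree a + degree b))
degree true′            = 0
degree false′           = 0
degree (if′ a b c)      = suc (suc (degree a + suc (degree b + degree c)))
degree zero′            = 0
degree (suc′ a)         = suc (degree a)
degree (natrec′ a z f)  = suc (suc (suc (degree a + degree z) + suc (suc (degree f))))
degree (pair′ a b)      = suc (suc (degree a + degree b))
degree (fst′ a)         = suc (degree a)
degree (snd′ a)         = suc (degree a)
degree nil′             = 0
degree (cons′ a b)      = suc (suc (degree a + degree b))
degree (listrec′ a z f) = suc (suc (suc (degree a + degree z) + suc (suc (degree f))))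

-- With base M = 2 + N ≥ 2 no coefficients are needed, because M ^ i + M ^ j ≤ M ^ (1 + i + j).

module _ (N : ℕ) where

  private
    M : ℕ
    M = suc (suc N)

  record _≼_ (x i : ℕ) : Set where
    constructor ⟨_⟩
    field unwrap : x ≤ M ^ i

  open _≼_

  one-≼ : 1 ≼ 0
  one-≼ = ⟨ ≤-refl ⟩

  +-≼ : ∀ {i j x y} → x ≼ i → y ≼ j → (x + y) ≼ suc (i + j)
  +-≼ {i} {j} {x} {y} ⟨ p ⟩ ⟨ q ⟩ = ⟨ begin
    x + y                          ≤⟨ +-mono-≤ p q ⟩
    M ^ i + M ^ j                  ≤⟨ +-mono-≤ (m≤m*n (M ^ i) (M ^ j)) (m≤n*m (M ^ j) (M ^ i)) ⟩
    M ^ i * M ^ j + M ^ i * M ^ j  ≡⟨ cong (λ w → w + w) (sym (^-distribˡ-+-* M i j)) ⟩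
    M ^ (i + j) + M ^ (i + j)      ≤⟨ +-monoʳ-≤ (M ^ (i + j)) (m≤m+n (M ^ (i + j)) _) ⟩
    M ^ suc (i + j)                ∎ ⟩
    where
    open ≤-Reasoning
    instance
      _ = m^n≢0 M i
      _ = m^n≢0 M j

  suc-≼ : ∀ {i x} → x ≼ i → suc x ≼ suc i
  suc-≼ = +-≼ one-≼

  rec-≼ : ∀ {i x} → x ≼ i → (N * suc x) ≼ suc (suc i)
  rec-≼ p = ⟨ *-mono-≤ (≤-trans (n≤1+n N) (n≤1+n (suc N))) (unwrap (suc-≼ p)) ⟩

  costBound-≼ : ∀ {Γ τ} (t : Tm Γ τ) → costBound t N ≼ degree t
  costBound-≼ (var i)          = one-≼
  costBound-≼ (let′ a b)       = suc-≼ (+-≼ (costBound-≼ a) (costBound-≼ b))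
  costBound-≼ true′            = one-≼
  costBound-≼ false′           = one-≼
  costBound-≼ (if′ a b c)      =
    suc-≼ (+-≼ (costBound-≼ a) (+-≼ (costBound-≼ b) (costBound-≼ c)))
  costBound-≼ zero′            = one-≼
  costBound-≼ (suc′ a)         = suc-≼ (costBound-≼ a)
  costBound-≼ (natrec′ a z f)  =
    suc-≼ (+-≼ (+-≼ (costBound-≼ a) (costBound-≼ z)) (rec-≼ (costBound-≼ f)))
  costBound-≼ (pair′ a b)      = suc-≼ (+-≼ (costBound-≼ a) (costBound-≼ b))
  costBound-≼ (fst′ a)         = suc-≼ (costBound-≼ a)
  costBound-≼ (snd′ a)         = suc-≼ (costBound-≼ a)
  costBound-≼ nil′             = one-≼
  costBound-≼ (cons′ a b)      = suc-≼ (+-≼ (costBound-≼ a) (costBound-≼ b))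
  costBound-≼ (listrec′ a z f) =
    suc-≼ (+-≼ (+-≼ (costBound-≼ a) (costBound-≼ z)) (rec-≼ (costBound-≼ f)))

cost-polynomial : ∀ {Γ τ} (t : Tm Γ τ) (ρ : Env Γ) {N} → Small N t ρ →
                  cost t ρ ≤ suc (suc N) ^ degree t
cost-polynomial t ρ {N} small =
  ≤-trans (cost≤costBound t ρ small) (_≼_.unwrap (costBound-≼ N t))

-- Connectivity by merging labels

module _ {n : ℕ} where

  -- Adjacency again, but for edge tables of any length and a Boolean selection, so that inductions
  -- can split off the first edge.
  Link : ∀ {m} → (Fin m → Fin n × Fin n) → (Fin m → Bool) → Fin n → Fin n → Set
  Link ends keep u v = ∃[ e ] keep e ≡ true × (ends e ≡ (u , v) ⊎ ends e ≡ (v , u))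

  Linked : ∀ {m} → (Fin m → Fin n × Fin n) → (Fin m → Bool) → Fin n → Fin n → Set
  Linked ends keep = Star (Link ends keep)

  Link-sym : ∀ {m} (ends : Fin m → Fin n × Fin n) keep {u v} → Link ends keep u v → Link ends keep v u
  Link-sym ends keep (e , k , p) = e , k , Sum.swap p

  Linked-sym : ∀ {m} {ends : Fin m → Fin n × Fin n} {keep u v} →
               Linked ends keep u v → Linked ends keep v u
  Linked-sym {ends = ends} {keep} = Star.reverse {T = Link ends keep} (Link-sym ends keep)

  merge : Fin n × Fin n → (Fin n → Fin n) → Fin n → Fin n
  merge (a , b) ℓ v = if does (ℓ v Fin.≟ ℓ a) then ℓ b else ℓ v

  -- The tail comes first, as in `listRec`: the labels for the later edges are merged along the
  -- first edge.
  label : ∀ {m} → (Fin m → Fin n × Fin n) → (Fin m → Bool) → Fin n → Fin n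
  label {zero}  ends keep = λ v → v
  label {suc m} ends keep =
    if keep zero then merge (ends zero) (label (ends ∘ suc) (keep ∘ suc))
                 else label (ends ∘ suc) (keep ∘ suc)

  merge-≡ : ∀ ab ℓ {u v} → ℓ u ≡ ℓ v → merge ab ℓ u ≡ merge ab ℓ v
  merge-≡ (a , b) ℓ ℓu≡ℓv rewrite ℓu≡ℓv = refl

  merge-ends : ∀ a b ℓ → merge (a , b) ℓ a ≡ merge (a , b) ℓ b
  merge-ends a b ℓ with ℓ a Fin.≟ ℓ a | ℓ b Fin.≟ ℓ a
  ... | yes _ | yes _ = refl
  ... | yes _ | no _  = refl
  ... | no ≢  | _     = contradiction refl ≢

  -- Merging joins the class of `a` to that of `b` and changes nothing else, so a new equality leads
  -- across the edge in one of its two directions.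
  merge-cases : ∀ a b ℓ u v → merge (a , b) ℓ u ≡ merge (a , b) ℓ v →
                ℓ u ≡ ℓ v ⊎ (ℓ u ≡ ℓ a × ℓ b ≡ ℓ v) ⊎ (ℓ u ≡ ℓ b × ℓ a ≡ ℓ v)
  merge-cases a b ℓ u v eq with ℓ u Fin.≟ ℓ a | ℓ v Fin.≟ ℓ a
  ... | yes p | yes q = inj₁ (trans p (sym q))
  ... | yes p | no _  = inj₂ (inj₁ (p , eq))
  ... | no _  | yes q = inj₂ (inj₂ (eq , sym q))
  ... | no _  | no _  = inj₁ eq

  Linked-suc : ∀ {m} {ends : Fin (suc m) → Fin n × Fin n} {keep u v} →
               Linked (ends ∘ suc) (keep ∘ suc) u v → Linked ends keep u v
  Linked-suc = Star.map λ (e , p) → suc e , p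

  label-sound : ∀ {m} (ends : Fin m → Fin n × Fin n) keep {u v} →
                label ends keep u ≡ label ends keep v → Linked ends keep u v
  label-sound {zero}  ends keep refl = ε
  label-sound {suc m} ends keep {u} {v} eq with keep zero in k
  ... | false = Linked-suc (label-sound (ends ∘ suc) (keep ∘ suc) eq)
  ... | true  with merge-cases _ _ (label (ends ∘ suc) (keep ∘ suc)) u v eq
  ...   | inj₁ p = Linked-suc (label-sound (ends ∘ suc) (keep ∘ suc) p)
  ...   | inj₂ (inj₁ (p , q)) = Linked-suc (label-sound (ends ∘ suc) (keep ∘ suc) p) ◅◅
                                (zero , k , inj₁ refl) ◅ Linked-suc (label-sound (ends ∘ suc) (keep ∘ suc) q)
  ...   | inj₂ (inj₂ (p , q)) = Linked-suc (label-sound (ends ∘ suc) (keep ∘ suc) p) ◅◅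
                                (zero , k , inj₂ refl) ◅ Linked-suc (label-sound (ends ∘ suc) (keep ∘ suc) q)

  label-link : ∀ {m} (ends : Fin m → Fin n × Fin n) keep e → keep e ≡ true →
               label ends keep (proj₁ (ends e)) ≡ label ends keep (proj₂ (ends e))
  label-link ends keep zero    k rewrite k = merge-ends _ _ (label (ends ∘ suc) (keep ∘ suc))
  label-link ends keep (suc e) k with keep zero
  ... | true  = merge-≡ (ends zero) (label (ends ∘ suc) (keep ∘ suc)) (label-link (ends ∘ suc) (keep ∘ suc) e k)
  ... | false = label-link (ends ∘ suc) (keep ∘ suc) e k

  label-complete : ∀ {m} (ends : Fin m → Fin n × Fin n) keep {u v} →
                   Linked ends keep u v → label ends keep u ≡ label ends keep v
  label-complete ends keep ε = refl
  label-complete ends keep ((e , k , inj₁ refl) ◅ p) =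
    trans (label-link ends keep e k) (label-complete ends keep p)
  label-complete ends keep ((e , k , inj₂ refl) ◅ p) =
    trans (sym (label-link ends keep e k)) (label-complete ends keep p)

  opaque

    linked? : ∀ {m} (ends : Fin m → Fin n × Fin n) keep u v → Dec (Linked ends keep u v)
    linked? ends keep u v =
      map′ (label-sound ends keep) (label-complete ends keep) (label ends keep u Fin.≟ label ends keep v)

  opaque
    unfolding linked?

    does-linked? : ∀ {m} (ends : Fin m → Fin n × Fin n) keep u v →
                   does (label ends keep u Fin.≟ label ends keep v) ≡ does (linked? ends keep u v)
    does-linked? ends keep u v = refl

-- rank e is the number of edges after e in the edge list; the programs use it as the name of e.

rank : ∀ {m} → Fin m → ℕ
rank {suc m} zero    = m
rank {suc m} (suc e) = rank e

rank<m : ∀ {m} (e : Fin m) → rank e < m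
rank<m {suc m} zero    = ≤-refl
rank<m {suc m} (suc e) = m<n⇒m<1+n (rank<m e)

rank-injective : ∀ {m} (e f : Fin m) → rank e ≡ rank f → e ≡ f
rank-injective zero    zero    _  = refl
rank-injective zero    (suc f) eq = contradiction eq (>⇒≢ (rank<m f))
rank-injective (suc e) zero    eq = contradiction eq (<⇒≢ (rank<m e))
rank-injective (suc e) (suc f) eq = cong suc (rank-injective e f eq)

-- The algorithm: critical edges, terminals and demands.

avoiding : ℕ → ℕ → ℕ → Bool
avoiding i j k = if k ≡ᵇ i then false else (if k ≡ᵇ j then false else true)

collect : ∀ {n m} → (Fin m → Fin n × Fin n) → (Fin m → Bool) → List (Fin n) → List (Fin n)
collect {m = zero}  ends keep base = base
collect {m = suc m} ends keep base =
  if keep zero then proj₁ (ends zero) ∷ proj₂ (ends zero) ∷ rest else rest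
  where rest = collect (ends ∘ suc) (keep ∘ suc) base

module Algorithm {n m : ℕ} (ends : Fin m → Fin n × Fin n) (s t : Fin n) where

  -- The argument is the `rank` of an edge, as this is all that a program has of it. That `f` may be
  -- the same edge does no harm: in a 2-edge-connected graph a single deletion leaves `s` and `t`
  -- linked.
  Critical : ℕ → Set
  Critical i = Σ[ f ∈ Fin m ] ¬ Linked ends (avoiding i (rank f) ∘ rank) s t

  critical? : ∀ i → Dec (Critical i)
  critical? i = any? λ f → ¬? (linked? ends (avoiding i (rank f) ∘ rank) s t)

  uncritical : ℕ → Bool
  uncritical i = if does (critical? i) then false else true

  terminals : List (Fin n)
  terminals = collect ends (does ∘ critical? ∘ rank) (s ∷ t ∷ [])

  demandsFrom : Fin n → List (Fin n) → List (Fin n × Fin n) → List (Fin n × Fin n)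
  demandsFrom u vs ds = listRec ds
    (λ v _ acc → if does (u Fin.≟ v) then acc else
      (if does (linked? ends (uncritical ∘ rank) u v) then (u , v) ∷ acc else acc)) vs

  demands : List (Fin n × Fin n)
  demands = listRec [] (λ u _ acc → demandsFrom u terminals acc) terminals

-- Programs

infix 9 _!_

_!_ : ∀ {Γ τ} → Env Γ → τ ∈ᴸ Γ → ⟦ τ ⟧
ρ ! i = All.lookup ρ i

pattern v0 = here refl
pattern v1 = there v0
pattern v2 = there v1
pattern v3 = there v2
pattern v4 = there v3
pattern v5 = there v4
pattern v6 = there v5

pattern there³ i = there (there (there i))
pattern there⁴ i = there (there³ i)

module _ {Γ : Ctx} where

  predP : nat ∈ᴸ Γ → Tm Γ nat
  predP x = natrec′ (var x) zero′ (var v0)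

  isZeroP : Tm Γ nat → Tm Γ bool
  isZeroP a = natrec′ a true′ false′

opaque
  subP : ∀ {Γ} → nat ∈ᴸ Γ → nat ∈ᴸ Γ → Tm Γ nat
  subP x y = natrec′ (var y) (var x) (predP v1)

opaque
  -- A vanishing truncated difference shows only ≤, so both differences are tested.
  eqP : ∀ {Γ} → nat ∈ᴸ Γ → nat ∈ᴸ Γ → Tm Γ bool
  eqP x y = if′ (isZeroP (subP x y)) (isZeroP (subP y x)) false′

opaque
  lengthP : ∀ {Γ σ} → list σ ∈ᴸ Γ → Tm Γ nat
  lengthP xs = listrec′ (var xs) zero′ (suc′ (var v2))

opaque
  lookP : ∀ {Γ} → vertexPairsTy ∈ᴸ Γ → nat ∈ᴸ Γ → Tm Γ nat
  lookP r a = listrec′ (var r) zero′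
    (let′ (fst′ (var v0)) (if′ (eqP v0 (there⁴ a)) (snd′ (var v1)) (var v3)))

opaque
  relabelP : ∀ {Γ} → vertexPairsTy ∈ᴸ Γ → nat ∈ᴸ Γ → nat ∈ᴸ Γ → Tm Γ vertexPairsTy
  relabelP r a b = listrec′ (var r) nil′ (let′ (snd′ (var v0))
    (cons′ (pair′ (fst′ (var v1)) (if′ (eqP v0 (there⁴ a)) (var (there⁴ b)) (var v0))) (var v3)))

record Vars (Γ : Ctx) : Set where
  constructor vars
  field
    nᵛ  : nat ∈ᴸ Γ
    esᵛ : vertexPairsTy ∈ᴸ Γ
    sᵛ  : nat ∈ᴸ Γ
    tᵛ  : nat ∈ᴸ Γ

open Vars

weaken : ∀ {Γ σ} → Vars Γ → Vars (σ ∷ Γ)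
weaken (vars n es s t) = vars (there n) (there es) (there s) (there t)

weaken³ : ∀ {Γ σ₁ σ₂ σ₃} → Vars Γ → Vars (σ₁ ∷ σ₂ ∷ σ₃ ∷ Γ)
weaken³ x = weaken (weaken (weaken x))

weaken⁴ : ∀ {Γ σ₁ σ₂ σ₃ σ₄} → Vars Γ → Vars (σ₁ ∷ σ₂ ∷ σ₃ ∷ σ₄ ∷ Γ)
weaken⁴ x = weaken (weaken³ x)

-- A test on edges is a term in the scope of an edge, the later edges and the current labels.

Test : Ctx → Set
Test Γ = Tm (pairTy ∷ vertexPairsTy ∷ vertexPairsTy ∷ Γ) bool

opaque
  initP : ∀ {Γ} → Vars Γ → Tm Γ vertexPairsTy
  initP x = natrec′ (var (nᵛ x)) nil′ (cons′ (pair′ (var v0) (var v0)) (var v1))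

opaque
  mergeP : ∀ {Γ} → Tm (pairTy ∷ vertexPairsTy ∷ vertexPairsTy ∷ Γ) vertexPairsTy
  mergeP =
    let′ (fst′ (var v0)) (let′ (lookP v3 v0) (let′ (snd′ (var v2)) (let′ (lookP v5 v0)
      (relabelP v6 v2 v0))))

opaque
  labelsP : ∀ {Γ} → Vars Γ → Test Γ → Tm Γ vertexPairsTy
  labelsP x keep = listrec′ (var (esᵛ x)) (initP x) (if′ keep mergeP (var v2))

opaque
  linkedP : ∀ {Γ} → Vars Γ → Test Γ → nat ∈ᴸ Γ → nat ∈ᴸ Γ → Tm Γ bool
  linkedP x keep u v = let′ (labelsP x keep)
    (let′ (lookP v0 (there u)) (let′ (lookP v1 (there (there v))) (eqP v1 v0)))

opaque
  avoidingP : ∀ {Γ} → nat ∈ᴸ Γ → nat ∈ᴸ Γ → Test Γ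
  avoidingP i j = let′ (lengthP v1)
    (if′ (eqP v0 (there⁴ i)) false′ (if′ (eqP v0 (there⁴ j)) false′ true′))

opaque
  criticalP : ∀ {Γ} → Vars Γ → nat ∈ᴸ Γ → Tm Γ bool
  criticalP x i = listrec′ (var (esᵛ x)) false′ (let′ (lengthP v1)
    (if′ (linkedP (weaken⁴ x) (avoidingP (there⁴ i) v0) (there⁴ (sᵛ x)) (there⁴ (tᵛ x)))
         (var v3) true′))

opaque
  uncriticalP : ∀ {Γ} → Vars Γ → Test Γ
  uncriticalP x = let′ (lengthP v1) (if′ (criticalP (weaken⁴ x) v0) false′ true′)

opaque
  terminalsP : ∀ {Γ} → Vars Γ → Tm Γ (list nat)
  terminalsP x = listrec′ (var (esᵛ x)) (cons′ (var (sᵛ x)) (cons′ (var (tᵛ x)) nil′))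
    (let′ (lengthP v1) (if′ (criticalP (weaken⁴ x) v0)
      (cons′ (fst′ (var v1)) (cons′ (snd′ (var v1)) (var v3))) (var v3)))

opaque
  demandsFromP : ∀ {Γ} → Vars Γ → nat ∈ᴸ Γ → list nat ∈ᴸ Γ → vertexPairsTy ∈ᴸ Γ → Tm Γ vertexPairsTy
  demandsFromP x u vs ds = listrec′ (var vs) (var ds) (if′ (eqP (there³ u) v0) (var v2)
    (if′ (linkedP (weaken³ x) (uncriticalP (weaken³ x)) (there³ u) v0)
         (cons′ (pair′ (var (there³ u)) (var v0)) (var v2)) (var v2)))

opaque
  demandsP : ∀ {Γ} → Vars Γ → Tm Γ vertexPairsTy
  demandsP x = let′ (terminalsP x)
    (listrec′ (var v0) nil′ (demandsFromP (weaken⁴ x) v0 v3 v2))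

opaque
  program : Program instanceTy vertexPairsTy
  program =
    let′ (fst′ (var v0)) (let′ (fst′ (snd′ (var v1)))
      (let′ (fst′ (snd′ (snd′ (snd′ (var v2))))) (let′ (snd′ (snd′ (snd′ (snd′ (var v3)))))
        (demandsP (vars v3 v2 v1 v0)))))

-- Evaluation

listRec-cong : ∀ {A B : Set} {z : B} {f g : A → List A → B → B} →
               (∀ x xs r → f x xs r ≡ g x xs r) → ∀ xs → listRec z f xs ≡ listRec z g xs
listRec-cong f≡g []       = refl
listRec-cong {g = g} f≡g (x ∷ xs) = trans (f≡g x xs _) (cong (g x xs) (listRec-cong f≡g xs))

listRec-map : ∀ {A A′ B B′ : Set} (g : A → A′) (h : B → B′)
              {z : B} {f : A → List A → B → B} {f′ : A′ → List A′ → B′ → B′} →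
              (∀ x xs r → f′ (g x) (map g xs) (h r) ≡ h (f x xs r)) →
              ∀ xs → listRec (h z) f′ (map g xs) ≡ h (listRec z f xs)
listRec-map g h step []       = refl
listRec-map g h {f′ = f′} step (x ∷ xs) =
  trans (cong (f′ (g x) (map g xs)) (listRec-map g h step xs)) (step x xs _)

opaque
  unfolding subP

  eval-subP : ∀ {Γ} (x y : nat ∈ᴸ Γ) ρ → eval (subP x y) ρ ≡ ρ ! x ∸ ρ ! y
  eval-subP x y ρ = go (ρ ! x) (ρ ! y)
    where
    pred′ : ℕ → ℕ
    pred′ = natRec 0 (λ k _ → k)

    pred′≡ : ∀ k → pred′ k ≡ pred k
    pred′≡ zero    = refl
    pred′≡ (suc k) = refl

    go : ∀ a b → natRec a (λ _ → pred′) b ≡ a ∸ b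
    go a zero    = refl
    go a (suc b) = trans (pred′≡ (natRec a (λ _ → pred′) b)) (trans (cong pred (go a b)) (pred[m∸n]≡m∸[1+n] a b))

opaque
  unfolding eqP

  eval-eqP : ∀ {Γ} (x y : nat ∈ᴸ Γ) ρ → eval (eqP x y) ρ ≡ (ρ ! x ≡ᵇ ρ ! y)
  eval-eqP x y ρ rewrite eval-subP x y ρ | eval-subP y x ρ = go (ρ ! x) (ρ ! y)
    where
    isZero : ℕ → Bool
    isZero = natRec true (λ _ _ → false)

    go : ∀ a b → (if isZero (a ∸ b) then isZero (b ∸ a) else false) ≡ (a ≡ᵇ b)
    go zero    zero    = refl
    go zero    (suc b) = refl
    go (suc a) zero    = refl
    go (suc a) (suc b) = go a b

≡ᵇ-toℕ : ∀ {n} (u v : Fin n) → (toℕ u ≡ᵇ toℕ v) ≡ does (u Fin.≟ v)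
≡ᵇ-toℕ zero    zero    = refl
≡ᵇ-toℕ zero    (suc v) = refl
≡ᵇ-toℕ (suc u) zero    = refl
≡ᵇ-toℕ (suc u) (suc v) = ≡ᵇ-toℕ u v

opaque
  unfolding lengthP

  eval-lengthP : ∀ {Γ σ} (xs : list σ ∈ᴸ Γ) ρ → eval (lengthP xs) ρ ≡ length (ρ ! xs)
  eval-lengthP {σ = σ} xs ρ = go (ρ ! xs)
    where
    go : ∀ (l : List ⟦ σ ⟧) → listRec 0 (λ _ _ → suc) l ≡ length l
    go []      = refl
    go (_ ∷ l) = cong suc (go l)

-- The default 0 is never returned where this is applied: a table of labels has every vertex as a
-- key.
look : List (ℕ × ℕ) → ℕ → ℕ
look r a = listRec 0 (λ p _ acc → if proj₁ p ≡ᵇ a then proj₂ p else acc) r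

opaque
  unfolding lookP

  eval-lookP : ∀ {Γ} (r : vertexPairsTy ∈ᴸ Γ) a ρ → eval (lookP r a) ρ ≡ look (ρ ! r) (ρ ! a)
  eval-lookP r a ρ = listRec-cong
    (λ p ps acc → cong (if_then proj₂ p else acc) (eval-eqP v0 (there⁴ a) (proj₁ p ∷ p ∷ ps ∷ acc ∷ ρ)))
    (ρ ! r)

relabel : ℕ → ℕ → List (ℕ × ℕ) → List (ℕ × ℕ)
relabel a b = map (λ p → proj₁ p , (if proj₂ p ≡ᵇ a then b else proj₂ p))

opaque
  unfolding relabelP

  eval-relabelP : ∀ {Γ} (r : vertexPairsTy ∈ᴸ Γ) a b ρ →
                  eval (relabelP r a b) ρ ≡ relabel (ρ ! a) (ρ ! b) (ρ ! r)
  eval-relabelP r a b ρ = go (ρ ! r)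
    where
    step : ℕ × ℕ → List (ℕ × ℕ) → List (ℕ × ℕ) → List (ℕ × ℕ)
    step p ps acc = (proj₁ p , (if eval (eqP v0 (there⁴ a)) (proj₂ p ∷ p ∷ ps ∷ acc ∷ ρ)
      then ρ ! b else proj₂ p)) ∷ acc

    go : ∀ l → listRec [] step l ≡ relabel (ρ ! a) (ρ ! b) l
    go []       = refl
    go (p ∷ ps) = cong₂ (λ c qs → (proj₁ p , (if c then ρ ! b else proj₂ p)) ∷ qs)
      (eval-eqP v0 (there⁴ a) (proj₂ p ∷ p ∷ ps ∷ listRec [] step ps ∷ ρ)) (go ps)

-- The list of labels, in the order in which initP lists the vertices.

labelList : ∀ {n} → (Fin n → Fin n) → List (ℕ × ℕ)
labelList ℓ = tabulate λ i → encodePair (opposite i , ℓ (opposite i))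

-- The first matching entry wins; injective keys make it the intended one.
look-tabulate : ∀ {n k} (key val : Fin k → Fin n) → (∀ i j → key i ≡ key j → i ≡ j) → ∀ j →
                look (tabulate (λ i → encodePair (key i , val i))) (toℕ (key j)) ≡ toℕ (val j)
look-tabulate key val inj zero
  rewrite ≡ᵇ-toℕ (key zero) (key zero) with key zero Fin.≟ key zero
... | yes _ = refl
... | no ≢  = contradiction refl ≢
look-tabulate key val inj (suc j)
  rewrite ≡ᵇ-toℕ (key zero) (key (suc j)) with key zero Fin.≟ key (suc j)
... | yes eq = contradiction (inj zero (suc j) eq) λ ()
... | no _   = look-tabulate (key ∘ suc) (val ∘ suc)
                 (λ i i′ eq → Fin.suc-injective (inj (suc i) (suc i′) eq)) j

look-labelList : ∀ {n} (ℓ : Fin n → Fin n) v → look (labelList ℓ) (toℕ v) ≡ toℕ (ℓ v)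
look-labelList ℓ v =
  subst (λ w → look (labelList ℓ) (toℕ w) ≡ toℕ (ℓ w)) (opposite-involutive v)
        (look-tabulate opposite (ℓ ∘ opposite) opposite-injective (opposite v))
  where
  opposite-injective : ∀ i j → opposite i ≡ opposite j → i ≡ j
  opposite-injective i j eq =
    trans (sym (opposite-involutive i)) (trans (cong opposite eq) (opposite-involutive j))

relabel-labelList : ∀ {n} ab (ℓ : Fin n → Fin n) →
  relabel (toℕ (ℓ (proj₁ ab))) (toℕ (ℓ (proj₂ ab))) (labelList ℓ) ≡ labelList (merge ab ℓ)
relabel-labelList (a , b) ℓ = trans (map-tabulate _ _) (tabulate-cong λ i →
  cong (toℕ (opposite i) ,_) (new (ℓ (opposite i))))
  where
  new : ∀ x → (if toℕ x ≡ᵇ toℕ (ℓ a) then toℕ (ℓ b) else toℕ x) ≡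
              toℕ (if does (x Fin.≟ ℓ a) then ℓ b else x)
  new x rewrite ≡ᵇ-toℕ x (ℓ a) with x Fin.≟ ℓ a
  ... | yes _ = refl
  ... | no _  = refl

-- The recursor puts the largest vertex at the head and 0 at the end, which is the origin of
-- `opposite` in `labelList`.
natRec-labelList : ∀ n → natRec [] (λ k r → (k , k) ∷ r) n ≡ labelList {n} (λ v → v)
natRec-labelList zero    = refl
natRec-labelList (suc n) = cong₂ _∷_ (cong₂ _,_ (sym (toℕ-fromℕ n)) (sym (toℕ-fromℕ n)))
  (trans (natRec-labelList n) (tabulate-cong λ i →
    cong₂ _,_ (sym (toℕ-inject₁ (opposite i))) (sym (toℕ-inject₁ (opposite i)))))

-- A test may depend on the edge only through the number of later edges, which is its `rank`;
-- neither its ends nor the current labels may matter.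
Decides : ∀ {Γ} → Test Γ → Env Γ → (ℕ → Bool) → Set
Decides keep ρ k = ∀ x xs r → eval keep (x ∷ xs ∷ r ∷ ρ) ≡ k (length xs)

opaque
  unfolding mergeP

  eval-mergeP : ∀ {Γ n} (ρ : Env Γ) ab xs (ℓ : Fin n → Fin n) →
                eval mergeP (encodePair ab ∷ xs ∷ labelList ℓ ∷ ρ) ≡ labelList (merge ab ℓ)
  eval-mergeP {Γ} {n} ρ ab@(a , b) xs ℓ = begin
    eval (relabelP v6 v2 v0) ρ₄
      ≡⟨ eval-relabelP v6 v2 v0 ρ₄ ⟩
    relabel la lb (labelList ℓ)
      ≡⟨ cong₂ (λ x y → relabel x y (labelList ℓ)) la≡ lb≡ ⟩
    relabel (toℕ (ℓ a)) (toℕ (ℓ b)) (labelList ℓ)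
      ≡⟨ relabel-labelList ab ℓ ⟩
    labelList (merge ab ℓ) ∎
    where
    open ≡-Reasoning
    ρ₁ : Env (nat ∷ pairTy ∷ vertexPairsTy ∷ vertexPairsTy ∷ Γ)
    ρ₁ = toℕ a ∷ encodePair ab ∷ xs ∷ labelList ℓ ∷ ρ
    la : ℕ
    la = eval (lookP v3 v0) ρ₁
    ρ₃ : Env (nat ∷ nat ∷ nat ∷ pairTy ∷ vertexPairsTy ∷ vertexPairsTy ∷ Γ)
    ρ₃ = toℕ b ∷ la ∷ ρ₁
    lb : ℕ
    lb = eval (lookP v5 v0) ρ₃
    ρ₄ : Env (nat ∷ nat ∷ nat ∷ nat ∷ pairTy ∷ vertexPairsTy ∷ vertexPairsTy ∷ Γ)
    ρ₄ = lb ∷ ρ₃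
    la≡ : la ≡ toℕ (ℓ a)
    la≡ = trans (eval-lookP v3 v0 ρ₁) (look-labelList ℓ a)
    lb≡ : lb ≡ toℕ (ℓ b)
    lb≡ = trans (eval-lookP v5 v0 ρ₃) (look-labelList ℓ b)

module Correctness {n m : ℕ} (ends : Fin m → Fin n × Fin n) (s t : Fin n) where

  open Algorithm ends s t

  Holds : ∀ {Γ} → Vars Γ → Env Γ → Set
  Holds x ρ = ρ ! nᵛ x ≡ n × ρ ! esᵛ x ≡ tabulate (encodePair ∘ ends) ×
              ρ ! sᵛ x ≡ toℕ s × ρ ! tᵛ x ≡ toℕ t

  labelsRec : ∀ {Γ} → Test Γ → Env Γ → List (ℕ × ℕ) → List (ℕ × ℕ)
  labelsRec keep ρ = listRec (labelList {n} (λ v → v))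
    (λ x xs r → eval (if′ keep mergeP (var v2)) (x ∷ xs ∷ r ∷ ρ))

  labelsRec-tabulate : ∀ {Γ} (keep : Test Γ) ρ {k} → Decides keep ρ k →
    ∀ {m} (ends : Fin m → Fin n × Fin n) →
    labelsRec keep ρ (tabulate (encodePair ∘ ends)) ≡ labelList (label ends (k ∘ rank))
  labelsRec-tabulate keep ρ dec {zero} ends = refl
  labelsRec-tabulate keep ρ {k} dec {suc m} ends =
    trans (cong step (labelsRec-tabulate keep ρ {k} dec (ends ∘ suc)))
      (trans (cong (if_then eval mergeP (x₀ ∷ xs ∷ labelList ℓ ∷ ρ) else labelList ℓ)
                   -- The first edge is followed by `m` edges, and `m` is its `rank`.
                   (trans (dec x₀ xs (labelList ℓ)) (cong k (length-tabulate (encodePair ∘ ends ∘ suc)))))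
             (choose (k m)))
    where
    x₀ = encodePair (ends zero)
    xs = tabulate (encodePair ∘ ends ∘ suc)
    ℓ = label (ends ∘ suc) (k ∘ rank)

    step : List (ℕ × ℕ) → List (ℕ × ℕ)
    step r = eval (if′ keep mergeP (var v2)) (x₀ ∷ xs ∷ r ∷ ρ)

    choose : ∀ c → (if c then eval mergeP (x₀ ∷ xs ∷ labelList ℓ ∷ ρ) else labelList ℓ) ≡
                   labelList (if c then merge (ends zero) ℓ else ℓ)
    choose true  = eval-mergeP ρ (ends zero) xs ℓ
    choose false = refl

  opaque
    unfolding labelsP initP

    eval-labelsP : ∀ {Γ} (x : Vars Γ) keep ρ {k} → Holds x ρ → Decides keep ρ k →
                   eval (labelsP x keep) ρ ≡ labelList (label ends (k ∘ rank))
    eval-labelsP x keep ρ {k} (n≡ , es≡ , _) dec rewrite n≡ | es≡ | natRec-labelList n =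
      labelsRec-tabulate keep ρ {k} dec ends

  opaque
    unfolding linkedP

    eval-linkedP : ∀ {Γ} (x : Vars Γ) keep u v ρ {k} → Holds x ρ → Decides keep ρ k →
                   ∀ a b → ρ ! u ≡ toℕ a → ρ ! v ≡ toℕ b →
                   eval (linkedP x keep u v) ρ ≡ does (linked? ends (k ∘ rank) a b)
    eval-linkedP {Γ} x keep u v ρ {k} holds dec a b u≡ v≡ = begin
      eval (eqP v1 v0) ρ₃             ≡⟨ eval-eqP v1 v0 ρ₃ ⟩
      (la ≡ᵇ lb)                      ≡⟨ cong₂ _≡ᵇ_ la≡ lb≡ ⟩
      (toℕ (ℓ a) ≡ᵇ toℕ (ℓ b))        ≡⟨ trans (≡ᵇ-toℕ (ℓ a) (ℓ b)) (does-linked? ends (k ∘ rank) a b) ⟩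
      does (linked? ends (k ∘ rank) a b) ∎
      where
      open ≡-Reasoning
      ℓ : Fin n → Fin n
      ℓ = label ends (k ∘ rank)
      ρ₁ : Env (vertexPairsTy ∷ Γ)
      ρ₁ = eval (labelsP x keep) ρ ∷ ρ
      la : ℕ
      la = eval (lookP v0 (there u)) ρ₁
      ρ₂ : Env (nat ∷ vertexPairsTy ∷ Γ)
      ρ₂ = la ∷ ρ₁
      lb : ℕ
      lb = eval (lookP v1 (there (there v))) ρ₂
      ρ₃ : Env (nat ∷ nat ∷ vertexPairsTy ∷ Γ)
      ρ₃ = lb ∷ ρ₂
      la≡ : la ≡ toℕ (ℓ a)
      la≡ = trans (eval-lookP v0 (there u) ρ₁)
        (trans (cong₂ look (eval-labelsP x keep ρ {k} holds dec) u≡) (look-labelList ℓ a))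
      lb≡ : lb ≡ toℕ (ℓ b)
      lb≡ = trans (eval-lookP v1 (there (there v)) ρ₂)
        (trans (cong₂ look (eval-labelsP x keep ρ {k} holds dec) v≡) (look-labelList ℓ b))

  opaque
    unfolding avoidingP

    decides-avoidingP : ∀ {Γ} (i j : nat ∈ᴸ Γ) ρ → Decides (avoidingP i j) ρ (avoiding (ρ ! i) (ρ ! j))
    decides-avoidingP {Γ} i j ρ x xs r = begin
      eval (avoidingP i j) (x ∷ xs ∷ r ∷ ρ)
        ≡⟨ cong₂ (λ p q → if p then false else (if q then false else true))
                 (eval-eqP v0 (there⁴ i) ρ₁) (eval-eqP v0 (there⁴ j) ρ₁) ⟩
      avoiding (ρ ! i) (ρ ! j) (eval (lengthP v1) (x ∷ xs ∷ r ∷ ρ))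
        ≡⟨ cong (avoiding (ρ ! i) (ρ ! j)) (eval-lengthP v1 (x ∷ xs ∷ r ∷ ρ)) ⟩
      avoiding (ρ ! i) (ρ ! j) (length xs) ∎
      where
      open ≡-Reasoning
      ρ₁ : Env (nat ∷ pairTy ∷ vertexPairsTy ∷ vertexPairsTy ∷ Γ)
      ρ₁ = eval (lengthP v1) (x ∷ xs ∷ r ∷ ρ) ∷ x ∷ xs ∷ r ∷ ρ

  -- The step recognises the edge `j` by the length of the remaining list, hence the premise on
  -- `length xs`. Starting from `false`, the recursion turns to `true` at an edge that fails `P?`,
  -- which makes it the disjunction computed by `any?`.
  any-listRec : ∀ {A : Set} {m} (h : Fin m → A) {P : Fin m → Set} (P? : ∀ f → Dec (P f))
                (f : A → List A → Bool → Bool) →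
                (∀ j xs b → length xs ≡ rank j → f (h j) xs b ≡ (if does (P? j) then b else true)) →
                listRec false f (tabulate h) ≡ does (any? (λ j → ¬? (P? j)))
  any-listRec {m = zero}  h P? f f≡ = refl
  any-listRec {m = suc m} h P? f f≡ =
    trans (f≡ zero (tabulate (h ∘ suc)) _ (length-tabulate (h ∘ suc)))
          (trans (cong (if does (P? zero) then_else true)
                       (any-listRec (h ∘ suc) (P? ∘ suc) f (λ j → f≡ (suc j))))
                 (∨-form (does (P? zero)) _))
    where
    ∨-form : ∀ c b → (if c then b else true) ≡ not c ∨ b
    ∨-form true  b = refl
    ∨-form false b = refl

  opaque
    unfolding criticalP

    eval-criticalP : ∀ {Γ} (x : Vars Γ) i ρ → Holds x ρ →
                     eval (criticalP x i) ρ ≡ does (critical? (ρ ! i))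
    eval-criticalP {Γ} x i ρ holds@(_ , es≡ , s≡ , t≡) =
      trans (cong (listRec false step) es≡)
            (any-listRec (encodePair ∘ ends)
              (λ f → linked? ends (avoiding (ρ ! i) (rank f) ∘ rank) s t) step step≡)
      where
      step : ℕ × ℕ → List (ℕ × ℕ) → Bool → Bool
      step y ys b = eval
        (let′ (lengthP v1)
          (if′ (linkedP (weaken⁴ x) (avoidingP (there⁴ i) v0) (there⁴ (sᵛ x)) (there⁴ (tᵛ x)))
               (var v3) true′))
        (y ∷ ys ∷ b ∷ ρ)

      step≡ : ∀ j ys b → length ys ≡ rank j → step (encodePair (ends j)) ys b ≡
              (if does (linked? ends (avoiding (ρ ! i) (rank j) ∘ rank) s t) then b else true)
      step≡ j ys b len = cong (if_then b else true)
        (trans (eval-linkedP (weaken⁴ x) (avoidingP (there⁴ i) v0) (there⁴ (sᵛ x)) (there⁴ (tᵛ x))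
                  (k ∷ ρ₁) {avoiding (ρ ! i) k} holds (decides-avoidingP (there⁴ i) v0 (k ∷ ρ₁)) s t s≡ t≡)
               (cong (λ r → does (linked? ends (avoiding (ρ ! i) r ∘ rank) s t))
                     (trans (eval-lengthP v1 ρ₁) len)))
        where
        ρ₁ : Env (pairTy ∷ vertexPairsTy ∷ bool ∷ Γ)
        ρ₁ = encodePair (ends j) ∷ ys ∷ b ∷ ρ

        k : ℕ
        k = eval (lengthP v1) ρ₁

  opaque
    unfolding uncriticalP

    decides-uncriticalP : ∀ {Γ} (x : Vars Γ) ρ → Holds x ρ → Decides (uncriticalP x) ρ uncritical
    decides-uncriticalP {Γ} x ρ holds y ys r =
      trans (cong (if_then false else true)
                  (eval-criticalP (weaken⁴ x) v0 (eval (lengthP v1) ρ₁ ∷ ρ₁) holds))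
            (cong uncritical (eval-lengthP v1 ρ₁))
      where
      ρ₁ : Env (pairTy ∷ vertexPairsTy ∷ vertexPairsTy ∷ Γ)
      ρ₁ = y ∷ ys ∷ r ∷ ρ

  opaque
    unfolding terminalsP

    eval-terminalsP : ∀ {Γ} (x : Vars Γ) ρ → Holds x ρ → eval (terminalsP x) ρ ≡ map toℕ terminals
    eval-terminalsP {Γ} x ρ holds@(_ , es≡ , s≡ , t≡) =
      trans (cong₂ (λ es base → listRec base step es) es≡ (cong₂ (λ a b → a ∷ b ∷ []) s≡ t≡)) (go ends)
      where
      select : Bool → ℕ × ℕ → List ℕ → List ℕ
      select c y r = if c then proj₁ y ∷ proj₂ y ∷ r else r

      step : ℕ × ℕ → List (ℕ × ℕ) → List ℕ → List ℕ
      step y ys r = eval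
        (let′ (lengthP v1) (if′ (criticalP (weaken⁴ x) v0)
          (cons′ (fst′ (var v1)) (cons′ (snd′ (var v1)) (var v3))) (var v3)))
        (y ∷ ys ∷ r ∷ ρ)

      step≡ : ∀ y ys r → step y ys r ≡ select (does (critical? (length ys))) y r
      step≡ y ys r = cong (λ c → select c y r)
        (trans (eval-criticalP (weaken⁴ x) v0 (eval (lengthP v1) ρ₁ ∷ ρ₁) holds)
               (cong (λ i → does (critical? i)) (eval-lengthP v1 ρ₁)))
        where
        ρ₁ : Env (pairTy ∷ vertexPairsTy ∷ list nat ∷ Γ)
        ρ₁ = y ∷ ys ∷ r ∷ ρ

      choose : ∀ c (ab : Fin n × Fin n) us → select c (encodePair ab) (map toℕ us) ≡
               map toℕ (if c then proj₁ ab ∷ proj₂ ab ∷ us else us)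
      choose true  ab us = refl
      choose false ab us = refl

      go : ∀ {m} (ends : Fin m → Fin n × Fin n) →
           listRec (toℕ s ∷ toℕ t ∷ []) step (tabulate (encodePair ∘ ends)) ≡
           map toℕ (collect ends (does ∘ critical? ∘ rank) (s ∷ t ∷ []))
      go {zero}  ends = refl
      go {suc m} ends =
        trans (step≡ (encodePair (ends zero)) (tabulate (encodePair ∘ ends ∘ suc)) _)
          (trans (cong₂ (λ i r → select (does (critical? i)) (encodePair (ends zero)) r)
                        (length-tabulate (encodePair ∘ ends ∘ suc)) (go (ends ∘ suc)))
                 (choose (does (critical? m)) (ends zero) _))

  opaque
    unfolding demandsFromP

    eval-demandsFromP : ∀ {Γ} (x : Vars Γ) u vs ds ρ → Holds x ρ →
      ∀ a bs cs → ρ ! u ≡ toℕ a → ρ ! vs ≡ map toℕ bs → ρ ! ds ≡ map encodePair cs →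
      eval (demandsFromP x u vs ds) ρ ≡ map encodePair (demandsFrom a bs cs)
    eval-demandsFromP {Γ} x u vs ds ρ holds a bs cs u≡ vs≡ ds≡ rewrite vs≡ | ds≡ =
      listRec-map toℕ (map encodePair) step bs
      where
      select : Bool → Bool → ℕ × ℕ → List (ℕ × ℕ) → List (ℕ × ℕ)
      select p q d acc = if p then acc else (if q then d ∷ acc else acc)

      step : ∀ b (bs : List (Fin n)) (acc : List (Fin n × Fin n)) →
        eval (if′ (eqP (there³ u) v0) (var v2)
               (if′ (linkedP (weaken³ x) (uncriticalP (weaken³ x)) (there³ u) v0)
                    (cons′ (pair′ (var (there³ u)) (var v0)) (var v2)) (var v2)))
             (toℕ b ∷ map toℕ bs ∷ map encodePair acc ∷ ρ)
        ≡ map encodePair (if does (a Fin.≟ b) then acc else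
            (if does (linked? ends (uncritical ∘ rank) a b) then (a , b) ∷ acc else acc))
      step b bs acc =
        trans (cong₂ (λ p q → select p q (ρ ! u , toℕ b) (map encodePair acc))
                (trans (eval-eqP (there³ u) v0 ρ₁) (trans (cong (_≡ᵇ toℕ b) u≡) (≡ᵇ-toℕ a b)))
                (eval-linkedP (weaken³ x) (uncriticalP (weaken³ x)) (there³ u) v0 ρ₁ {uncritical} holds
                  (decides-uncriticalP (weaken³ x) ρ₁ holds) a b u≡ refl))
              (choose (does (a Fin.≟ b)) (does (linked? ends (uncritical ∘ rank) a b)))
        where
        ρ₁ : Env (nat ∷ list nat ∷ vertexPairsTy ∷ Γ)
        ρ₁ = toℕ b ∷ map toℕ bs ∷ map encodePair acc ∷ ρ

        choose : ∀ p q → select p q (ρ ! u , toℕ b) (map encodePair acc) ≡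
                 map encodePair (if p then acc else (if q then (a , b) ∷ acc else acc))
        choose true  _     = refl
        choose false true  = cong (λ z → (z , toℕ b) ∷ map encodePair acc) u≡
        choose false false = refl

  opaque
    unfolding demandsP

    eval-demandsP : ∀ {Γ} (x : Vars Γ) ρ → Holds x ρ → eval (demandsP x) ρ ≡ map encodePair demands
    eval-demandsP x ρ holds rewrite eval-terminalsP x ρ holds =
      listRec-map toℕ (map encodePair) (λ u us r →
        eval-demandsFromP (weaken⁴ x) v0 v3 v2 (toℕ u ∷ map toℕ us ∷ map encodePair r ∷ map toℕ terminals ∷ ρ)
          holds u terminals r refl refl refl) terminals

-- Running time

natRecAll : ∀ {A : Set} {z : A} {f P} → (∀ k → P k (natRec z f k)) → ∀ k → NatRecAll z f P k
natRecAll p zero    = tt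
natRecAll p (suc k) = p k , natRecAll p k

natRec-≤ : ∀ {z f} → (∀ k r → f k r ≤ r) → ∀ k → natRec z f k ≤ z
natRec-≤ f≤ zero    = ≤-refl
natRec-≤ f≤ (suc k) = ≤-trans (f≤ k _) (natRec-≤ f≤ k)

-- For steps that are small whatever the accumulator is. The one list recursion outside its scope is
-- that of `labelsP`, whose accumulator must be a table of labels for the lookups to stay below `N`.
listRecAll : ∀ {A B : Set} {Q : A → Set} {N} {z : B} {f P} →
             (∀ x xs r → Q x → length xs ≤ N → P x xs r) →
             ∀ xs → All Q xs → length xs ≤ N → ListRecAll z f P xs
listRecAll p []       _        _ = tt
listRecAll p (x ∷ xs) (q ∷ qs) l =
  p x xs _ q (≤-trans (n≤1+n _) l) , listRecAll p xs qs (≤-trans (n≤1+n _) l)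

module _ (N : ℕ) where

  BoundedPair : ℕ × ℕ → Set
  BoundedPair p = proj₁ p ≤ N × proj₂ p ≤ N

  Bounded : List (ℕ × ℕ) → Set
  Bounded ps = All BoundedPair ps × length ps ≤ N

  opaque
    unfolding subP

    small-subP : ∀ {Γ} (x y : nat ∈ᴸ Γ) ρ → ρ ! x ≤ N → ρ ! y ≤ N → Small N (subP x y) ρ
    small-subP x y ρ x≤ y≤ = tt , tt , y≤ , natRecAll
      -- The intermediate differences never exceed the first operand, which bounds the inner
      -- recursion.
      (λ k → tt , tt , ≤-trans (natRec-≤ pred≤ k) x≤ , natRecAll (λ _ → tt) _) (ρ ! y)
      where
      pred≤ : ∀ (k : ℕ) r → natRec 0 (λ j _ → j) r ≤ r
      pred≤ k zero    = z≤n
      pred≤ k (suc r) = n≤1+n r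

  opaque
    unfolding eqP

    small-eqP : ∀ {Γ} (x y : nat ∈ᴸ Γ) ρ → ρ ! x ≤ N → ρ ! y ≤ N → Small N (eqP x y) ρ
    small-eqP x y ρ x≤ y≤ = small-isZeroP x y x≤ y≤ , small-isZeroP y x y≤ x≤ , tt
      where
      small-isZeroP : ∀ x y → ρ ! x ≤ N → ρ ! y ≤ N → Small N (isZeroP (subP x y)) ρ
      small-isZeroP x y x≤ y≤ = small-subP x y ρ x≤ y≤ , tt ,
        ≤-trans (≤-reflexive (eval-subP x y ρ)) (≤-trans (m∸n≤m (ρ ! x) (ρ ! y)) x≤) ,
        natRecAll (λ _ → tt) _

  opaque
    unfolding lengthP

    small-lengthP : ∀ {Γ σ} (xs : list σ ∈ᴸ Γ) ρ → length (ρ ! xs) ≤ N → Small N (lengthP xs) ρ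
    small-lengthP {σ = σ} xs ρ l = tt , tt , l ,
      listRecAll {Q = Trivial} (λ _ _ _ _ _ → tt) (ρ ! xs) (All.universal (λ _ → tt) _) l
      where
      Trivial : ⟦ σ ⟧ → Set
      Trivial _ = Unit

  opaque
    unfolding lookP

    small-lookP : ∀ {Γ} (r : vertexPairsTy ∈ᴸ Γ) a ρ → Bounded (ρ ! r) → ρ ! a ≤ N → Small N (lookP r a) ρ
    small-lookP r a ρ (ps≤ , l) a≤ = tt , tt , l , listRecAll
      (λ p ps acc (k≤ , _) _ → tt , small-eqP v0 (there⁴ a) (proj₁ p ∷ p ∷ ps ∷ acc ∷ ρ) k≤ a≤ , tt , tt)
      (ρ ! r) ps≤ l

  opaque
    unfolding relabelP

    small-relabelP : ∀ {Γ} (r : vertexPairsTy ∈ᴸ Γ) a b ρ → Bounded (ρ ! r) → ρ ! a ≤ N →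
                     Small N (relabelP r a b) ρ
    small-relabelP r a b ρ (ps≤ , l) a≤ = tt , tt , l , listRecAll
      (λ p ps acc (_ , v≤) _ → tt ,
        (tt , small-eqP v0 (there⁴ a) (proj₂ p ∷ p ∷ ps ∷ acc ∷ ρ) v≤ a≤ , tt , tt) , tt)
      (ρ ! r) ps≤ l

-- The second bound is the length of the list of terminals: two entries for every edge at worst, and
-- `s` and `t`.
module SmallPrograms {n m : ℕ} (ends : Fin m → Fin n × Fin n) (s t : Fin n)
                     (N : ℕ) (n≤N : n ≤ N) (2+2m≤N : 2 + (m + m) ≤ N) where

  open Algorithm ends s t
  open Correctness ends s t

  toℕ≤N : (v : Fin n) → toℕ v ≤ N
  toℕ≤N v = ≤-trans (<⇒≤ (toℕ<n v)) n≤N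

  m≤N : m ≤ N
  m≤N = ≤-trans (m≤m+n m m) (≤-trans (m≤n+m (m + m) 2) 2+2m≤N)

  bounded-labelList : (ℓ : Fin n → Fin n) → Bounded N (labelList ℓ)
  bounded-labelList ℓ =
    All.tabulate⁺ (λ i → toℕ≤N (opposite i) , toℕ≤N (ℓ (opposite i))) ,
    ≤-trans (≤-reflexive (length-tabulate _)) n≤N

  bounded-ends : ∀ {l} (ends : Fin l → Fin n × Fin n) → l ≤ N → Bounded N (tabulate (encodePair ∘ ends))
  bounded-ends ends l≤N =
    All.tabulate⁺ (λ e → toℕ≤N (proj₁ (ends e)) , toℕ≤N (proj₂ (ends e))) ,
    ≤-trans (≤-reflexive (length-tabulate _)) l≤N

  bounded-es : ∀ {Γ} (x : Vars Γ) ρ → Holds x ρ → Bounded N (ρ ! esᵛ x)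
  bounded-es x ρ (_ , es≡ , _) = subst (Bounded N) (sym es≡) (bounded-ends ends m≤N)

  SmallTest : ∀ {Γ} → Test Γ → Env Γ → Set
  SmallTest keep ρ = ∀ y ys r → length ys ≤ N → Small N keep (y ∷ ys ∷ r ∷ ρ)

  look≤N : ∀ {Γ} (r : vertexPairsTy ∈ᴸ Γ) a ρ (ℓ : Fin n → Fin n) v →
           ρ ! r ≡ labelList ℓ → ρ ! a ≡ toℕ v → eval (lookP r a) ρ ≤ N
  look≤N r a ρ ℓ v r≡ a≡ = subst (_≤ N)
    (sym (trans (eval-lookP r a ρ) (trans (cong₂ look r≡ a≡) (look-labelList ℓ v)))) (toℕ≤N (ℓ v))

  opaque
    unfolding mergeP

    small-mergeP : ∀ {Γ} (ρ : Env Γ) ab xs (ℓ : Fin n → Fin n) → Small N mergeP (encodePair {n} ab ∷ xs ∷ labelList ℓ ∷ ρ)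
    small-mergeP {Γ} ρ (a , b) xs ℓ =
      tt , small-lookP N v3 v0 ρ₁ (bounded-labelList ℓ) (toℕ≤N a) ,
      tt , small-lookP N v5 v0 ρ₃ (bounded-labelList ℓ) (toℕ≤N b) ,
      small-relabelP N v6 v2 v0 (eval (lookP v5 v0) ρ₃ ∷ ρ₃) (bounded-labelList ℓ)
        (look≤N v3 v0 ρ₁ ℓ a refl refl)
      where
      ρ₁ : Env (nat ∷ pairTy ∷ vertexPairsTy ∷ vertexPairsTy ∷ Γ)
      ρ₁ = toℕ a ∷ encodePair (a , b) ∷ xs ∷ labelList ℓ ∷ ρ
      ρ₃ : Env (nat ∷ nat ∷ nat ∷ pairTy ∷ vertexPairsTy ∷ vertexPairsTy ∷ Γ)
      ρ₃ = toℕ b ∷ eval (lookP v3 v0) ρ₁ ∷ ρ₁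

  opaque
    unfolding labelsP initP

    small-labelsP : ∀ {Γ} (x : Vars Γ) keep ρ {k} → Holds x ρ → Decides keep ρ k → SmallTest keep ρ →
                    Small N (labelsP x keep) ρ
    small-labelsP x keep ρ {k} holds@(n≡ , es≡ , _) dec small =
      tt , (tt , tt , ≤-trans (≤-reflexive n≡) n≤N , natRecAll (λ _ → (tt , tt) , tt) (ρ ! nᵛ x)) ,
      proj₂ (bounded-es x ρ holds) ,
      -- Over the tabulated edges and the identity labels, every accumulator is a known `labelList`.
      subst₂ (λ z es → ListRecAll z step P es)
        (sym (trans (cong (natRec [] (λ k r → (k , k) ∷ r)) n≡) (natRec-labelList n))) (sym es≡) (go ends m≤N)
      where
      step : ℕ × ℕ → List (ℕ × ℕ) → List (ℕ × ℕ) → List (ℕ × ℕ)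
      step x xs r = eval (if′ keep mergeP (var v2)) (x ∷ xs ∷ r ∷ ρ)

      P : ℕ × ℕ → List (ℕ × ℕ) → List (ℕ × ℕ) → Set
      P x xs r = Small N (if′ keep mergeP (var v2)) (x ∷ xs ∷ r ∷ ρ)

      go : ∀ {l} (ends : Fin l → Fin n × Fin n) → l ≤ N →
           ListRecAll (labelList {n} (λ v → v)) step P (tabulate (encodePair ∘ ends))
      go {zero}  ends l≤N = tt
      go {suc l} ends l≤N =
        (small _ xs _ (proj₂ (bounded-ends (ends ∘ suc) (≤-trans (n≤1+n l) l≤N))) ,
         subst (λ r → Small N mergeP (encodePair (ends zero) ∷ xs ∷ r ∷ ρ))
               (sym (labelsRec-tabulate keep ρ {k} dec (ends ∘ suc)))
               (small-mergeP ρ (ends zero) xs (label (ends ∘ suc) (k ∘ rank))) ,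
         tt) ,
        go (ends ∘ suc) (≤-trans (n≤1+n l) l≤N)
        where
        xs : List (ℕ × ℕ)
        xs = tabulate (encodePair ∘ ends ∘ suc)

  opaque
    unfolding linkedP

    small-linkedP : ∀ {Γ} (x : Vars Γ) keep u v ρ {k} → Holds x ρ → Decides keep ρ k → SmallTest keep ρ →
                    ∀ (a b : Fin n) → ρ ! u ≡ toℕ a → ρ ! v ≡ toℕ b → Small N (linkedP x keep u v) ρ
    small-linkedP {Γ} x keep u v ρ {k} holds dec small a b u≡ v≡ =
      small-labelsP x keep ρ {k} holds dec small ,
      small-lookP N v0 (there u) ρ₁ bounded (subst (_≤ N) (sym u≡) (toℕ≤N a)) ,
      small-lookP N v1 (there (there v)) ρ₂ bounded (subst (_≤ N) (sym v≡) (toℕ≤N b)) ,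
      small-eqP N v1 v0 ρ₃ (look≤N v0 (there u) ρ₁ ℓ a labels≡ u≡)
                           (look≤N v1 (there (there v)) ρ₂ ℓ b labels≡ v≡)
      where
      ℓ : Fin n → Fin n
      ℓ = label ends (k ∘ rank)
      ρ₁ : Env (vertexPairsTy ∷ Γ)
      ρ₁ = eval (labelsP x keep) ρ ∷ ρ
      ρ₂ : Env (nat ∷ vertexPairsTy ∷ Γ)
      ρ₂ = eval (lookP v0 (there u)) ρ₁ ∷ ρ₁
      ρ₃ : Env (nat ∷ nat ∷ vertexPairsTy ∷ Γ)
      ρ₃ = eval (lookP v1 (there (there v))) ρ₂ ∷ ρ₂
      labels≡ : eval (labelsP x keep) ρ ≡ labelList ℓ
      labels≡ = eval-labelsP x keep ρ {k} holds dec
      bounded : Bounded N (eval (labelsP x keep) ρ)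
      bounded = subst (Bounded N) (sym labels≡) (bounded-labelList ℓ)

  length≤N : ∀ {Γ σ} (xs : list σ ∈ᴸ Γ) ρ → length (ρ ! xs) ≤ N → eval (lengthP xs) ρ ≤ N
  length≤N xs ρ = subst (_≤ N) (sym (eval-lengthP xs ρ))

  opaque
    unfolding avoidingP

    small-avoidingP : ∀ {Γ} (i j : nat ∈ᴸ Γ) ρ → ρ ! i ≤ N → ρ ! j ≤ N → SmallTest (avoidingP i j) ρ
    small-avoidingP {Γ} i j ρ i≤ j≤ y ys r l =
      small-lengthP N v1 ρ₁ l ,
      small-eqP N v0 (there⁴ i) (eval (lengthP v1) ρ₁ ∷ ρ₁) (length≤N v1 ρ₁ l) i≤ , tt ,
      small-eqP N v0 (there⁴ j) (eval (lengthP v1) ρ₁ ∷ ρ₁) (length≤N v1 ρ₁ l) j≤ , tt , tt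
      where
      ρ₁ : Env (pairTy ∷ vertexPairsTy ∷ vertexPairsTy ∷ Γ)
      ρ₁ = y ∷ ys ∷ r ∷ ρ

  opaque
    unfolding criticalP

    small-criticalP : ∀ {Γ} (x : Vars Γ) i ρ → Holds x ρ → ρ ! i ≤ N → Small N (criticalP x i) ρ
    small-criticalP {Γ} x i ρ holds@(_ , _ , s≡ , t≡) i≤ =
      tt , tt , proj₂ es≤ , listRecAll step (ρ ! esᵛ x) (proj₁ es≤) (proj₂ es≤)
      where
      es≤ : Bounded N (ρ ! esᵛ x)
      es≤ = bounded-es x ρ holds

      step : ∀ y (ys : List (ℕ × ℕ)) (b : Bool) → BoundedPair N y → length ys ≤ N → Small N
        (let′ (lengthP v1)
          (if′ (linkedP (weaken⁴ x) (avoidingP (there⁴ i) v0) (there⁴ (sᵛ x)) (there⁴ (tᵛ x)))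
               (var v3) true′))
        (y ∷ ys ∷ b ∷ ρ)
      step y ys b _ l = small-lengthP N v1 ρ₁ l ,
        small-linkedP (weaken⁴ x) (avoidingP (there⁴ i) v0) (there⁴ (sᵛ x)) (there⁴ (tᵛ x)) (j ∷ ρ₁)
          {avoiding (ρ ! i) j} holds (decides-avoidingP (there⁴ i) v0 (j ∷ ρ₁))
          (small-avoidingP (there⁴ i) v0 (j ∷ ρ₁) i≤ (length≤N v1 ρ₁ l)) s t s≡ t≡ ,
        tt , tt
        where
        ρ₁ : Env (pairTy ∷ vertexPairsTy ∷ bool ∷ Γ)
        ρ₁ = y ∷ ys ∷ b ∷ ρ
        j : ℕ
        j = eval (lengthP v1) ρ₁

  opaque
    unfolding uncriticalP

    small-uncriticalP : ∀ {Γ} (x : Vars Γ) ρ → Holds x ρ → SmallTest (uncriticalP x) ρ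
    small-uncriticalP {Γ} x ρ holds y ys r l =
      small-lengthP N v1 ρ₁ l ,
      small-criticalP (weaken⁴ x) v0 (eval (lengthP v1) ρ₁ ∷ ρ₁) holds (length≤N v1 ρ₁ l) , tt , tt
      where
      ρ₁ : Env (pairTy ∷ vertexPairsTy ∷ vertexPairsTy ∷ Γ)
      ρ₁ = y ∷ ys ∷ r ∷ ρ

  opaque
    unfolding terminalsP

    small-terminalsP : ∀ {Γ} (x : Vars Γ) ρ → Holds x ρ → Small N (terminalsP x) ρ
    small-terminalsP {Γ} x ρ holds =
      tt , (tt , tt , tt) , proj₂ es≤ , listRecAll
        (λ y ys r _ l → let ρ₁ = y ∷ ys ∷ r ∷ ρ in
          small-lengthP N v1 ρ₁ l ,
          small-criticalP (weaken⁴ x) v0 (eval (lengthP v1) ρ₁ ∷ ρ₁) holds (length≤N v1 ρ₁ l) ,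
          (tt , tt , tt) , tt)
        (ρ ! esᵛ x) (proj₁ es≤) (proj₂ es≤)
      where
      es≤ : Bounded N (ρ ! esᵛ x)
      es≤ = bounded-es x ρ holds

  length-collect : ∀ {l} (ends : Fin l → Fin n × Fin n) keep base →
                   length (collect ends keep base) ≤ (l + l) + length base
  length-collect {zero}  ends keep base = ≤-refl
  length-collect {suc l} ends keep base rewrite +-suc l l with keep zero
  ... | true  = s≤s (s≤s (length-collect (ends ∘ suc) (keep ∘ suc) base))
  ... | false = m≤n⇒m≤1+n (m≤n⇒m≤1+n (length-collect (ends ∘ suc) (keep ∘ suc) base))

  length-terminals : length (map toℕ terminals) ≤ N
  length-terminals = begin
    length (map toℕ terminals)  ≡⟨ length-map toℕ terminals ⟩
    length terminals            ≤⟨ length-collect ends _ (s ∷ t ∷ []) ⟩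
    (m + m) + 2                 ≡⟨ +-comm (m + m) 2 ⟩
    2 + (m + m)                 ≤⟨ 2+2m≤N ⟩
    N                           ∎
    where open ≤-Reasoning

  -- A bound on the number would not do here: `small-linkedP` looks it up in the table of labels, so
  -- it has to be a vertex.
  InRange : ℕ → Set
  InRange j = ∃[ v ] j ≡ toℕ {n} v

  inRange-terminals : All InRange (map toℕ terminals)
  inRange-terminals = All.map⁺ (All.universal (λ v → v , refl) terminals)

  opaque
    unfolding demandsFromP

    small-demandsFromP : ∀ {Γ} (x : Vars Γ) u vs ds ρ → Holds x ρ →
      InRange (ρ ! u) → ρ ! vs ≡ map toℕ terminals → Small N (demandsFromP x u vs ds) ρ
    small-demandsFromP {Γ} x u vs ds ρ holds (a , u≡) vs≡ =
      tt , tt , vs≤ , listRecAll step (ρ ! vs) (subst (All InRange) (sym vs≡) inRange-terminals) vs≤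
      where
      vs≤ : length (ρ ! vs) ≤ N
      vs≤ = subst (λ l → length l ≤ N) (sym vs≡) length-terminals

      step : ∀ y (ys : List ℕ) (r : List (ℕ × ℕ)) → InRange y → length ys ≤ N → Small N
        (if′ (eqP (there³ u) v0) (var v2)
          (if′ (linkedP (weaken³ x) (uncriticalP (weaken³ x)) (there³ u) v0)
               (cons′ (pair′ (var (there³ u)) (var v0)) (var v2)) (var v2)))
        (y ∷ ys ∷ r ∷ ρ)
      step y ys r (b , y≡) _ =
        small-eqP N (there³ u) v0 ρ₁ (subst (_≤ N) (sym u≡) (toℕ≤N a)) (subst (_≤ N) (sym y≡) (toℕ≤N b)) ,
        tt ,
        small-linkedP (weaken³ x) (uncriticalP (weaken³ x)) (there³ u) v0 ρ₁ {uncritical} holds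
          (decides-uncriticalP (weaken³ x) ρ₁ holds) (small-uncriticalP (weaken³ x) ρ₁ holds) a b u≡ y≡ ,
        ((tt , tt) , tt) , tt
        where
        ρ₁ : Env (nat ∷ list nat ∷ vertexPairsTy ∷ Γ)
        ρ₁ = y ∷ ys ∷ r ∷ ρ

  opaque
    unfolding demandsP

    small-demandsP : ∀ {Γ} (x : Vars Γ) ρ → Holds x ρ → Small N (demandsP x) ρ
    small-demandsP x ρ holds =
      small-terminalsP x ρ holds , tt , tt ,
      subst (λ l → length l ≤ N) (sym terminals≡) length-terminals ,
      listRecAll
        (λ u us r u∈ _ → small-demandsFromP (weaken⁴ x) v0 v3 v2
          (u ∷ us ∷ r ∷ eval (terminalsP x) ρ ∷ ρ) holds u∈ terminals≡)
        (eval (terminalsP x) ρ) (subst (All InRange) (sym terminals≡) inRange-terminals)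
        (subst (λ l → length l ≤ N) (sym terminals≡) length-terminals)
      where
      terminals≡ : eval (terminalsP x) ρ ≡ map toℕ terminals
      terminals≡ = eval-terminalsP x ρ holds

  opaque
    unfolding program

    small-program : ∀ ws → Small N program ((n , tabulate (encodePair ∘ ends) , ws , toℕ s , toℕ t) ∷ [])
    small-program ws = tt , tt , tt , tt ,
      small-demandsP (vars v3 v2 v1 v0) _ (refl , refl , refl , refl)

    eval-program : ∀ ws → run program (n , tabulate (encodePair ∘ ends) , ws , toℕ s , toℕ t) ≡
                   map encodePair demands
    eval-program ws = eval-demandsP (vars v3 v2 v1 v0) _ (refl , refl , refl , refl)

-- From the bound on recursions to the size of the encoding.

size-list≥length : ∀ τ (xs : List ⟦ τ ⟧) → length xs ≤ size (list τ) xs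
size-list≥length τ []       = z≤n
size-list≥length τ (x ∷ xs) = s≤s (≤-trans (size-list≥length τ xs) (m≤n+m _ (size τ x)))

^-distribʳ-* : ∀ k m o → (m * o) ^ k ≡ m ^ k * o ^ k
^-distribʳ-* zero    m o = refl
^-distribʳ-* (suc k) m o =
  trans (cong (m * o *_) (^-distribʳ-* k m o)) ([m*n]*[o*p]≡[m*o]*[n*p] m o (m ^ k) (o ^ k))

program-polynomial : ∀ (I : Instance) → let S = size instanceTy (encode I) in
                     time program (encode I) ≤ 4 ^ degree program * suc S ^ degree program
program-polynomial I = begin
  time program (encode I)                   ≤⟨ cost-polynomial program (encode I ∷ []) small ⟩
  suc (suc N) ^ degree program              ≤⟨ ^-monoˡ-≤ (degree program) N≤ ⟩
  (4 * suc S) ^ degree program              ≡⟨ ^-distribʳ-* (degree program) 4 (suc S) ⟩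
  4 ^ degree program * suc S ^ degree program ∎
  where
  open ≤-Reasoning
  open Instance I
  es : ⟦ vertexPairsTy ⟧
  es = tabulate (encodePair ∘ ends)

  ws : ⟦ list weightTy ⟧
  ws = tabulate (encodeWeight ∘ weight)

  S N : ℕ
  S = size instanceTy (encode I)
  -- Room for the 2 + 2m terminals, as `m` is at most `S`; `n` fits as well.
  N = 2 + (S + S)

  m≤S : m ≤ S
  m≤S = begin
    m                          ≡⟨ length-tabulate (encodePair ∘ ends) ⟨
    length es                  ≤⟨ size-list≥length pairTy es ⟩
    size vertexPairsTy es      ≤⟨ m≤m+n _ _ ⟩
    size vertexPairsTy es + size (list weightTy ⊗ nat ⊗ nat) (ws , toℕ s , toℕ t)
                               ≤⟨ n≤1+n _ ⟩
    size (vertexPairsTy ⊗ list weightTy ⊗ nat ⊗ nat) (es , ws , toℕ s , toℕ t)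
                               ≤⟨ m≤n+m _ (suc (suc n)) ⟩
    S                          ∎

  n≤S : n ≤ S
  n≤S = ≤-trans (n≤1+n n) (≤-trans (n≤1+n (suc n)) (m≤m+n (suc (suc n)) _))

  small : Small N program (encode I ∷ [])
  small = SmallPrograms.small-program ends s t N
    (≤-trans n≤S (≤-trans (m≤m+n S S) (m≤n+m (S + S) 2))) (+-monoʳ-≤ 2 (+-mono-≤ m≤S m≤S)) ws

  -- The base of the cost bound is `2 + N`, that is `4 + 2 * S`, whence the constant 4.
  N≤ : suc (suc N) ≤ 4 * suc S
  N≤ = begin
    4 + (S + S)                  ≤⟨ +-monoʳ-≤ 4 (+-monoʳ-≤ S (m≤m+n S (S + (S + 0)))) ⟩
    4 + 4 * S                    ≡⟨ *-suc 4 S ⟨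
    4 * suc S                    ∎

-- Cuts

true≢false : true ≢ false
true≢false ()

lookup-∉ : ∀ {k} {p : Subset k} {x} → x ∉ p → lookup p x ≡ false
lookup-∉ {p = p} {x} x∉p with lookup p x in eq
... | true  = contradiction (lookup⇒[]= x p eq) x∉p
... | false = refl

x∈p─q⇒x∉q : ∀ {k} {p q : Subset k} {x} → x ∈ p ─ q → x ∉ q
x∈p─q⇒x∉q {p = p} {q} {x} x∈ x∈q
  with lookup p x | lookup q x | []=⇒lookup x∈q | trans (sym (lookup-zipWith _ x p q)) ([]=⇒lookup x∈)
... | _ | true | _ | ()

∣p∣≤1+∣p-x∣ : ∀ {k} (p : Subset k) x → ∣ p ∣ ≤ suc ∣ p - x ∣
∣p∣≤1+∣p-x∣ p x = remove p x λ _ → refl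
  where
  -- Here `d` stands for the Boolean operation applied pointwise by `_─_`; the induction relies only
  -- on `d b false ≡ b`.
  module _ {d : Bool → Bool → Bool} where

    keep-⊥ : ∀ {k} (p : Subset k) → (∀ b → d b false ≡ b) → Vec.zipWith d p ⊥ ≡ p
    keep-⊥ []      d≡ = refl
    keep-⊥ (b ∷ p) d≡ = cong₂ _∷_ (d≡ b) (keep-⊥ p d≡)

    remove : ∀ {k} (p : Subset k) x → (∀ b → d b false ≡ b) → ∣ p ∣ ≤ suc ∣ Vec.zipWith d p ⁅ x ⁆ ∣
    remove (b ∷ p) zero d≡ rewrite keep-⊥ p d≡ = begin
      ∣ b ∷ p ∣                  ≤⟨ ∣x∷p∣≤1+∣p∣ b ⟩
      suc ∣ p ∣                  ≤⟨ s≤s (∣p∣≤∣x∷p∣ (d b true) p) ⟩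
      suc ∣ d b true ∷ p ∣       ∎
      where
      open ≤-Reasoning
      ∣x∷p∣≤1+∣p∣ : ∀ b → ∣ b ∷ p ∣ ≤ suc ∣ p ∣
      ∣x∷p∣≤1+∣p∣ true  = ≤-refl
      ∣x∷p∣≤1+∣p∣ false = n≤1+n ∣ p ∣
    remove (b ∷ p) (suc x) d≡ rewrite d≡ b with b
    ... | true  = s≤s (remove p x d≡)
    ... | false = remove p x d≡

x∈p⇒0<∣p∣ : ∀ {k} {p : Subset k} {x} → x ∈ p → 0 < ∣ p ∣
x∈p⇒0<∣p∣ x∈p = ≤-trans (s≤s z≤n) (x∈p⇒∣p-x∣<∣p∣ x∈p)

three-elements : ∀ {k} {p : Subset k} {x y z} → x ∈ p → y ∈ p → z ∈ p →
                 y ≢ x → z ≢ x → z ≢ y → 3 ≤ ∣ p ∣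
three-elements {p = p} {x} {y} {z} x∈ y∈ z∈ y≢x z≢x z≢y =
  ≤-trans (s≤s (≤-trans (s≤s (x∈p⇒0<∣p∣ z∈′)) (x∈p⇒∣p-x∣<∣p∣ y∈′))) (x∈p⇒∣p-x∣<∣p∣ x∈)
  where
  y∈′ : y ∈ p - x
  y∈′ = x∈p∧x≢y⇒x∈p-y y∈ y≢x
  z∈′ : z ∈ p - x - y
  z∈′ = x∈p∧x≢y⇒x∈p-y (x∈p∧x≢y⇒x∈p-y z∈ z≢x) z≢y

⊆∧∣∣≥⇒⊇ : ∀ {k} {p q : Subset k} → p ⊆ q → ∣ q ∣ ≤ ∣ p ∣ → q ⊆ p
⊆∧∣∣≥⇒⊇ {p = p} p⊆q q≤p {x} x∈q with x ∈? p
... | yes x∈p = x∈p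
... | no  x∉p = contradiction (p⊂q⇒∣p∣<∣q∣ (p⊆q , x , x∈q , x∉p)) (≤⇒≯ q≤p)

-- Nested, it turns a statement about several Booleans into one closed Boolean that can be
-- evaluated; `uncrossing` is proved in this way.
every : (Bool → Bool) → Bool
every f = f true ∧ f false

every-sound : ∀ f → every f ≡ true → ∀ b → f b ≡ true
every-sound f eq true  with f true | eq
... | true | _ = refl
every-sound f eq false with f true | eq
... | true | p = p

xor-cancel : ∀ {a b c d} → a xor c ≡ b xor d → c ≡ d → a ≡ b
xor-cancel {true}  {true}          _ _    = refl
xor-cancel {false} {false}         _ _    = refl
xor-cancel {true}  {false} {true}  p refl = sym p
xor-cancel {true}  {false} {false} p refl = p
xor-cancel {false} {true}  {true}  p refl = sym p
xor-cancel {false} {true}  {false} p refl = p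

xor-agree : ∀ {a b c d} → (a ≡ b → c ≡ d) → (c ≡ d → a ≡ b) → a xor c ≡ b xor d
xor-agree {true}  {true}                  f g rewrite f refl = refl
xor-agree {false} {false}                 f g rewrite f refl = refl
xor-agree {true}  {false} {true}  {true}  f g = contradiction (g refl) λ ()
xor-agree {true}  {false} {true}  {false} f g = refl
xor-agree {true}  {false} {false} {true}  f g = refl
xor-agree {true}  {false} {false} {false} f g = contradiction (g refl) λ ()
xor-agree {false} {true}  {true}  {true}  f g = contradiction (g refl) λ ()
xor-agree {false} {true}  {true}  {false} f g = refl
xor-agree {false} {true}  {false} {true}  f g = refl
xor-agree {false} {true}  {false} {false} f g = contradiction (g refl) λ ()

xor-≢ : ∀ {a b} → a ≢ b → a xor b ≡ true
xor-≢ {true}  {true}  p = contradiction refl p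
xor-≢ {true}  {false} p = refl
xor-≢ {false} {true}  p = refl
xor-≢ {false} {false} p = contradiction refl p

xor-≢⁻ : ∀ {a b} → a xor b ≡ true → a ≢ b
xor-≢⁻ {true}  () refl
xor-≢⁻ {false} () refl

∧-true : ∀ {a b} → a ∧ b ≡ true → a ≡ true × b ≡ true
∧-true {true} {true} _ = refl , refl

𝟙 : Bool → ℕ
𝟙 b = if b then 1 else 0

∣x∷p∣≡𝟙x+∣p∣ : ∀ {k} b (p : Subset k) → ∣ b ∷ p ∣ ≡ 𝟙 b + ∣ p ∣
∣x∷p∣≡𝟙x+∣p∣ true  p = refl
∣x∷p∣≡𝟙x+∣p∣ false p = refl

-- Cardinalities are sums of indicators, so an inequality between edge cuts may be checked edge by
-- edge. The doubled `w` will be the edges between the two parts, which both parts count.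
∣∣-mono-pointwise : ∀ {k} (p q r w : Fin k → Bool) →
  (∀ i → 𝟙 (p i) + 𝟙 (q i) ≤ 𝟙 (r i) + (𝟙 (w i) + 𝟙 (w i))) →
  ∣ Vec.tabulate p ∣ + ∣ Vec.tabulate q ∣ ≤
  ∣ Vec.tabulate r ∣ + (∣ Vec.tabulate w ∣ + ∣ Vec.tabulate w ∣)
∣∣-mono-pointwise {zero}  p q r w le = z≤n
∣∣-mono-pointwise {suc k} p q r w le
  rewrite ∣x∷p∣≡𝟙x+∣p∣ (p zero) (Vec.tabulate (p ∘ suc)) | ∣x∷p∣≡𝟙x+∣p∣ (q zero) (Vec.tabulate (q ∘ suc))
        | ∣x∷p∣≡𝟙x+∣p∣ (r zero) (Vec.tabulate (r ∘ suc)) | ∣x∷p∣≡𝟙x+∣p∣ (w zero) (Vec.tabulate (w ∘ suc)) = begin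
  (p₀ + P) + (q₀ + Q)              ≡⟨ interchange +-commutativeSemigroup p₀ P q₀ Q ⟩
  (p₀ + q₀) + (P + Q)              ≤⟨ +-mono-≤ (le zero) (∣∣-mono-pointwise (p ∘ suc) (q ∘ suc) (r ∘ suc) (w ∘ suc) (le ∘ suc)) ⟩
  (r₀ + (w₀ + w₀)) + (R + (W + W)) ≡⟨ interchange +-commutativeSemigroup r₀ (w₀ + w₀) R (W + W) ⟩
  (r₀ + R) + ((w₀ + w₀) + (W + W)) ≡⟨ cong ((r₀ + R) +_) (interchange +-commutativeSemigroup w₀ w₀ W W) ⟩
  (r₀ + R) + ((w₀ + W) + (w₀ + W)) ∎
  where
  open ≤-Reasoning
  p₀ = 𝟙 (p zero)
  q₀ = 𝟙 (q zero)
  r₀ = 𝟙 (r zero)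
  w₀ = 𝟙 (w zero)
  P = ∣ Vec.tabulate (p ∘ suc) ∣
  Q = ∣ Vec.tabulate (q ∘ suc) ∣
  R = ∣ Vec.tabulate (r ∘ suc) ∣
  W = ∣ Vec.tabulate (w ∘ suc) ∣

module Cuts (G : Graph) where
  open Graph G

  Incident : E → V → V → Set
  Incident e a b = ends e ≡ (a , b) ⊎ ends e ≡ (b , a)

  incident-ends : ∀ {e a b x y} → Incident e a b → Incident e x y → x ≡ a ⊎ x ≡ b
  incident-ends (inj₁ refl) (inj₁ refl) = inj₁ refl
  incident-ends (inj₁ refl) (inj₂ refl) = inj₂ refl
  incident-ends (inj₂ refl) (inj₁ refl) = inj₂ refl
  incident-ends (inj₂ refl) (inj₂ refl) = inj₁ refl

  -- The side is a Boolean function, so that reachability sets and Boolean combinations of sides can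
  -- be used as they are.
  cut : EdgeSet → (V → Bool) → EdgeSet
  cut H χ = Vec.tabulate λ e → lookup H e ∧ (χ (proj₁ (ends e)) xor χ (proj₂ (ends e)))

  δ≡cut : ∀ H A → δ G H A ≡ cut H (lookup A)
  δ≡cut H A = trans (sym (tabulate∘lookup (δ G H A))) (Vec.tabulate-cong λ e →
    trans (lookup-zipWith _∧_ e H _) (cong (lookup H e ∧_) (lookup∘tabulate _ e)))

  ∈-cut⁺ : ∀ {H} χ {e a b} → e ∈ H → Incident e a b → χ a ≢ χ b → e ∈ cut H χ
  ∈-cut⁺ {H} χ {e} e∈H i χa≢χb = lookup⇒[]= e _ (trans (lookup∘tabulate _ e)
    (trans (cong (_∧ _) ([]=⇒lookup e∈H)) (xor-≢ (ends-≢ i))))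
    where
    ends-≢ : Incident e _ _ → χ (proj₁ (ends e)) ≢ χ (proj₂ (ends e))
    ends-≢ (inj₁ eq) rewrite eq = χa≢χb
    ends-≢ (inj₂ eq) rewrite eq = χa≢χb ∘ sym

  ∈-cut⁻ : ∀ {H} χ {e} → e ∈ cut H χ → e ∈ H × (∀ {a b} → Incident e a b → χ a ≢ χ b)
  ∈-cut⁻ {H} χ {e} e∈ with ∧-true (trans (sym (lookup∘tabulate _ e)) ([]=⇒lookup e∈))
  ... | e∈H , χ≢ = lookup⇒[]= e H e∈H , λ where
    (inj₁ refl) → xor-≢⁻ χ≢
    (inj₂ refl) → xor-≢⁻ χ≢ ∘ sym

  δ-tabulate : ∀ H χ → δ G H (Vec.tabulate χ) ≡ cut H χ
  δ-tabulate H χ = trans (δ≡cut H (Vec.tabulate χ)) (Vec.tabulate-cong λ e → cong₂ (λ x y → lookup H e ∧ (x xor y))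
    (lookup∘tabulate χ (proj₁ (ends e))) (lookup∘tabulate χ (proj₂ (ends e))))

  Connected : (E → Bool) → V → V → Set
  Connected = Linked ends

  path⇒connected : ∀ {K u v} → HasPath G K u v → Connected (lookup K) u v
  path⇒connected = Star.map λ (e , e∈K , i) → e , []=⇒lookup e∈K , i

  connected⇒path : ∀ {K u v} → Connected (lookup K) u v → HasPath G K u v
  connected⇒path {K} = Star.map λ (e , k , i) → e , lookup⇒[]= e K k , i

  constant : ∀ (χ : V → Bool) {keep} → (∀ {e a b} → keep e ≡ true → Incident e a b → χ a ≡ χ b) →
             ∀ {u v} → Connected keep u v → χ u ≡ χ v
  constant χ same ε                 = refl
  constant χ same ((e , k , i) ◅ p) = trans (same k i) (constant χ same p)

  -- The edge found is the first to cross, and the path before it is kept: `terminal-connected` uses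
  -- it to reach the ends of that edge.
  crossing : ∀ (χ : V → Bool) {keep u v} → Connected keep u v → χ u ≢ χ v →
             ∃[ e ] ∃[ a ] ∃[ b ] keep e ≡ true × Incident e a b × χ a ≢ χ b × Connected keep u a
  crossing χ ε χu≢χv = contradiction refl χu≢χv
  crossing χ {u = u} (_◅_ {j = w} (e , k , i) p) χu≢χv with χ u Bool.≟ χ w
  ... | no χu≢χw = e , u , w , k , i , χu≢χw , ε
  ... | yes χu≡χw with crossing χ p (χu≢χv ∘ trans χu≡χw)
  ...   | f , a , b , k′ , i′ , χa≢χb , q = f , a , b , k′ , i′ , χa≢χb , (e , k , i) ◅ q

  reach : (E → Bool) → V → V → Bool
  reach keep u v = does (linked? ends keep u v)

  reach-refl : ∀ keep u → reach keep u u ≡ true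
  reach-refl keep u = dec-true (linked? ends keep u u) ε

  reach-step : ∀ keep u {e a b} → keep e ≡ true → Incident e a b → reach keep u a ≡ reach keep u b
  reach-step keep u {e} {a} {b} k i = does-⇔
    (mk⇔ (λ p → p ◅◅ (e , k , i) ◅ ε) (λ p → p ◅◅ (e , k , Sum.swap i) ◅ ε))
    (linked? ends keep u a) (linked? ends keep u b)

  -- A kept edge cannot leave the component of `u`, so the boundary of the component is made of
  -- deleted edges. With `∉-cut-path` this translates between disconnecting deletions and small
  -- cuts.
  reach-cut : ∀ keep u {H e} → e ∈ cut H (reach keep u) → keep e ≡ false
  reach-cut keep u {H} {e} e∈ with keep e in k
  ... | false = refl
  ... | true  = contradiction (reach-step keep u k (inj₁ refl)) (proj₂ (∈-cut⁻ {H} (reach keep u) e∈) (inj₁ refl))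

  ∉-cut-path : ∀ {H} χ {u v} → χ u ≢ χ v → ¬ HasPath G (H ─ cut H χ) u v
  ∉-cut-path {H} χ χu≢χv p with crossing χ (path⇒connected p) χu≢χv
  ... | e , a , b , k , i , χa≢χb , _ =
    x∈p─q⇒x∉q {p = H} e∈ (∈-cut⁺ χ (p─q⊆p H _ e∈) i χa≢χb)
    where
    e∈ : e ∈ H ─ cut H χ
    e∈ = lookup⇒[]= e _ k

  ∈-subsets : ∀ {k} (p : Subset k) → p ∈ᴸ subsets k
  ∈-subsets []          = here refl
  ∈-subsets (true  ∷ p) = ∈-++⁺ˡ (∈-map⁺ (inside ∷_) (∈-subsets p))
  ∈-subsets (false ∷ p) = ∈-++⁺ʳ _ (∈-map⁺ (outside ∷_) (∈-subsets p))

  Separates : V → V → VertexSet → Set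
  Separates u v A = u ∈ A × v ∉ A

  separates? : ∀ u v A → Dec (Separates u v A)
  separates? u v A = (u ∈? A) ×-dec ¬? (v ∈? A)

  satisfies⁻ : ∀ {H u v} → Satisfies G H (u , v) → ∀ (χ : V → Bool) → χ u ≡ true → χ v ≡ false →
               3 ≤ ∣ cut H χ ∣
  satisfies⁻ {H} {u} {v} sat χ χu χv = subst (λ p → 3 ≤ ∣ p ∣) (δ-tabulate H χ) (≤-trans sat
    (All.lookup (min≤xs ∣ H ∣ (map (λ A → ∣ δ G H A ∣) (separating G u v)))
      (∈-map⁺ (λ A → ∣ δ G H A ∣) (∈-filter⁺ (separates? u v) (∈-subsets A) (u∈A , v∉A)))))
    where
    A : VertexSet
    A = Vec.tabulate χ
    u∈A : u ∈ A
    u∈A = lookup⇒[]= u A (trans (lookup∘tabulate χ u) χu)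
    v∉A : v ∉ A
    v∉A v∈A = true≢false (trans (sym ([]=⇒lookup v∈A)) (trans (lookup∘tabulate χ v) χv))

  satisfies⁺ : ∀ {H u v} → u ≢ v → (∀ (χ : V → Bool) → χ u ≢ χ v → 3 ≤ ∣ cut H χ ∣) →
               Satisfies G H (u , v)
  satisfies⁺ {H} {u} {v} u≢v big = v<min⁺
    -- The initial value `∣ H ∣` of the minimum has to be at least 3 too; it bounds the cut around
    -- `⁅ u ⁆`, which separates `u` from `v` because they differ.
    (≤-trans (δ≥3 ⁅ u ⁆ (x∈⁅x⁆ u , λ v∈ → u≢v (sym (x∈⁅y⁆⇒x≡y u v∈)))) (∣p∩q∣≤∣p∣ H _))
    (All.map⁺ (All.map (δ≥3 _) (all-filter (separates? u v) (subsets n))))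
    where
    δ≥3 : ∀ A → Separates u v A → 3 ≤ ∣ δ G H A ∣
    δ≥3 A (u∈A , v∉A) rewrite δ≡cut H A = big (lookup A) λ eq →
      true≢false (trans (sym ([]=⇒lookup u∈A)) (trans eq (lookup-∉ v∉A)))

-- What the selections and lists of the algorithm contain.

≡ᵇ-refl : ∀ k → (k ≡ᵇ k) ≡ true
≡ᵇ-refl zero    = refl
≡ᵇ-refl (suc k) = ≡ᵇ-refl k

≡ᵇ-true : ∀ {j k} → (j ≡ᵇ k) ≡ true → j ≡ k
≡ᵇ-true {j} {k} eq = ≡ᵇ⇒≡ j k (subst T (sym eq) tt)

avoiding-true : ∀ i j {k} → avoiding i j k ≡ true → k ≢ i × k ≢ j
avoiding-true i j {k} eq with k ≡ᵇ i in p | k ≡ᵇ j in q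
... | false | false = (λ { refl → true≢false (trans (sym (≡ᵇ-refl k)) p) }) ,
                      (λ { refl → true≢false (trans (sym (≡ᵇ-refl k)) q) })

avoiding-false : ∀ i j {k} → avoiding i j k ≡ false → k ≡ i ⊎ k ≡ j
avoiding-false i j {k} eq with k ≡ᵇ i in p | k ≡ᵇ j in q
... | true  | _    = inj₁ (≡ᵇ-true p)
... | false | true = inj₂ (≡ᵇ-true q)

collect⁻ : ∀ {n m} (ends : Fin m → Fin n × Fin n) keep base {w} → w ∈ᴸ collect ends keep base →
           w ∈ᴸ base ⊎ ∃[ e ] keep e ≡ true × (w ≡ proj₁ (ends e) ⊎ w ≡ proj₂ (ends e))
collect⁻ {m = zero}  ends keep base w∈ = inj₁ w∈
collect⁻ {m = suc m} ends keep base w∈ with keep zero in k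
collect⁻ {m = suc m} ends keep base (here w≡)         | true = inj₂ (zero , k , inj₁ w≡)
collect⁻ {m = suc m} ends keep base (there (here w≡)) | true = inj₂ (zero , k , inj₂ w≡)
collect⁻ {m = suc m} ends keep base (there (there w∈)) | true =
  Sum.map₂ (λ (e , p) → suc e , p) (collect⁻ (ends ∘ suc) (keep ∘ suc) base w∈)
collect⁻ {m = suc m} ends keep base w∈ | false =
  Sum.map₂ (λ (e , p) → suc e , p) (collect⁻ (ends ∘ suc) (keep ∘ suc) base w∈)

collect-base : ∀ {n m} (ends : Fin m → Fin n × Fin n) keep base {w} → w ∈ᴸ base →
               w ∈ᴸ collect ends keep base
collect-base {m = zero}  ends keep base w∈ = w∈
collect-base {m = suc m} ends keep base w∈ with keep zero
... | true  = there (there (collect-base (ends ∘ suc) (keep ∘ suc) base w∈))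
... | false = collect-base (ends ∘ suc) (keep ∘ suc) base w∈

collect-ends : ∀ {n m} (ends : Fin m → Fin n × Fin n) keep base e {w} → keep e ≡ true →
               w ≡ proj₁ (ends e) ⊎ w ≡ proj₂ (ends e) → w ∈ᴸ collect ends keep base
collect-ends ends keep base zero k w≡ rewrite k with w≡
... | inj₁ eq = here eq
... | inj₂ eq = there (here eq)
collect-ends ends keep base (suc e) k w≡ with keep zero
... | true  = there (there (collect-ends (ends ∘ suc) (keep ∘ suc) base e k w≡))
... | false = collect-ends (ends ∘ suc) (keep ∘ suc) base e k w≡

module Demands {n m : ℕ} (ends : Fin m → Fin n × Fin n) (s t : Fin n) where
  open Algorithm ends s t

  Demand : Fin n → Fin n → Set
  Demand u v = u ≢ v × Linked ends (uncritical ∘ rank) u v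

  demandsFrom⁻ : ∀ u vs ds {d} → d ∈ᴸ demandsFrom u vs ds →
                 d ∈ᴸ ds ⊎ ∃[ v ] d ≡ (u , v) × v ∈ᴸ vs × Demand u v
  demandsFrom⁻ u []       ds d∈ = inj₁ d∈
  demandsFrom⁻ u (v ∷ vs) ds d∈ with u Fin.≟ v | linked? ends (uncritical ∘ rank) u v
  ... | yes _ | _ = Sum.map₂ (λ (w , p , q , r) → w , p , there q , r) (demandsFrom⁻ u vs ds d∈)
  ... | no _  | no _ = Sum.map₂ (λ (w , p , q , r) → w , p , there q , r) (demandsFrom⁻ u vs ds d∈)
  demandsFrom⁻ u (v ∷ vs) ds (here refl) | no u≢v | yes l = inj₂ (v , refl , here refl , u≢v , l)
  demandsFrom⁻ u (v ∷ vs) ds (there d∈)  | no _   | yes _ =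
    Sum.map₂ (λ (w , p , q , r) → w , p , there q , r) (demandsFrom⁻ u vs ds d∈)

  demandsFrom-old : ∀ u vs ds {d} → d ∈ᴸ ds → d ∈ᴸ demandsFrom u vs ds
  demandsFrom-old u []       ds d∈ = d∈
  demandsFrom-old u (v ∷ vs) ds d∈ with u Fin.≟ v | linked? ends (uncritical ∘ rank) u v
  ... | yes _ | _     = demandsFrom-old u vs ds d∈
  ... | no _  | no _  = demandsFrom-old u vs ds d∈
  ... | no _  | yes _ = there (demandsFrom-old u vs ds d∈)

  demandsFrom-new : ∀ u {v} vs ds → v ∈ᴸ vs → Demand u v → (u , v) ∈ᴸ demandsFrom u vs ds
  demandsFrom-new u (v ∷ vs) ds (here refl) (u≢v , l) with u Fin.≟ v | linked? ends (uncritical ∘ rank) u v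
  ... | yes u≡v | _     = contradiction u≡v u≢v
  ... | no _    | no ¬l = contradiction l ¬l
  ... | no _    | yes _ = here refl
  demandsFrom-new u (v ∷ vs) ds (there v∈) d with u Fin.≟ v | linked? ends (uncritical ∘ rank) u v
  ... | yes _ | _     = demandsFrom-new u vs ds v∈ d
  ... | no _  | no _  = demandsFrom-new u vs ds v∈ d
  ... | no _  | yes _ = there (demandsFrom-new u vs ds v∈ d)

  -- In `demands` one list is used in both roles; with two lists an induction can shrink the outer
  -- one alone.
  allDemands : List (Fin n) → List (Fin n) → List (Fin n × Fin n)
  allDemands us vs = listRec [] (λ u _ acc → demandsFrom u vs acc) us

  allDemands⁻ : ∀ us vs {u v} → (u , v) ∈ᴸ allDemands us vs → u ∈ᴸ us × v ∈ᴸ vs × Demand u v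
  allDemands⁻ (x ∷ us) vs d∈ with demandsFrom⁻ x vs (allDemands us vs) d∈
  ... | inj₁ d∈′ = let u∈ , p = allDemands⁻ us vs d∈′ in there u∈ , p
  ... | inj₂ (w , refl , w∈ , d) = here refl , w∈ , d

  allDemands⁺ : ∀ {us vs u v} → u ∈ᴸ us → v ∈ᴸ vs → Demand u v → (u , v) ∈ᴸ allDemands us vs
  allDemands⁺ {x ∷ us} {vs} (here refl) v∈ d = demandsFrom-new x vs (allDemands us vs) v∈ d
  allDemands⁺ {x ∷ us} {vs} (there u∈)  v∈ d = demandsFrom-old x vs (allDemands us vs) (allDemands⁺ u∈ v∈ d)

-- An edge is counted in d(P) + d(U) at most as often as in d(Z) + 2 e(P , U), where P and U are
-- the parts into which χ splits the complement of Z = {v | S v ≢ S s}.  Here h is membership in H,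
-- x and y are the values of χ, and p and q those of S, at the ends of the edge, and c = S s.

uncrossing : ∀ h x p y q c →
  𝟙 (h ∧ ((x ∧ not (p xor c)) xor (y ∧ not (q xor c)))) +
  𝟙 (h ∧ ((not x ∧ not (p xor c)) xor (not y ∧ not (q xor c)))) ≤
  𝟙 (h ∧ (p xor q)) +
  (𝟙 (h ∧ (x xor y) ∧ not (p xor c) ∧ not (q xor c)) + 𝟙 (h ∧ (x xor y) ∧ not (p xor c) ∧ not (q xor c)))
uncrossing h x p y q c = ≤ᵇ⇒≤ _ _ (subst T (sym holds) tt)
  where
  test : Bool → Bool → Bool → Bool → Bool → Bool → Bool
  test h x p y q c =
    𝟙 (h ∧ ((x ∧ not (p xor c)) xor (y ∧ not (q xor c)))) +
    𝟙 (h ∧ ((not x ∧ not (p xor c)) xor (not y ∧ not (q xor c)))) ≤ᵇ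
    𝟙 (h ∧ (p xor q)) +
    (𝟙 (h ∧ (x xor y) ∧ not (p xor c) ∧ not (q xor c)) + 𝟙 (h ∧ (x xor y) ∧ not (p xor c) ∧ not (q xor c)))

  holds : test h x p y q c ≡ true
  holds =
    -- One variable is released at each level; the `refl` at the centre evaluates all 64 cases.
    every-sound (test h x p y q)
      (every-sound (λ q → every (test h x p y q))
        (every-sound (λ y → every λ q → every (test h x p y q))
          (every-sound (λ p → every λ y → every λ q → every (test h x p y q))
            (every-sound (λ x → every λ p → every λ y → every λ q → every (test h x p y q))
              (every-sound (λ h → every λ x → every λ p → every λ y → every λ q → every (test h x p y q))
                refl h) x) p) y) q) c

-- Forced edges, and the equivalence of feasibility with the demands.

module _ (I : Instance) (2ec : TwoEdgeConnected (Instance.graph I)) where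
  open Instance I
  open Cuts graph
  open Algorithm ends s t
  open Demands ends s t

  IsForced : E → Set
  IsForced e = Σ[ χ ∈ (V → Bool) ] χ s ≡ true × χ t ≡ false × ∣ cut ⊤ χ ∣ ≡ 2 × e ∈ cut ⊤ χ

  forced⁺ : ∀ {e} → IsForced e → Forced I e
  forced⁺ {e} (χ , χs , χt , size≡2 , e∈) =
    A , lookup⇒[]= s A (trans (lookup∘tabulate χ s) χs) ,
    (λ t∈ → true≢false (trans (sym ([]=⇒lookup t∈)) (trans (lookup∘tabulate χ t) χt))) ,
    trans (cong ∣_∣ δ≡) size≡2 , subst (e ∈_) (sym δ≡) e∈
    where
    A : VertexSet
    A = Vec.tabulate χ
    δ≡ : δ graph ⊤ A ≡ cut ⊤ χ
    δ≡ = δ-tabulate ⊤ χ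

  -- Deleting a smaller cut would remove at most one edge and disconnect `x` from `y`.
  cut⊤≥2 : ∀ χ {x y} → χ x ≢ χ y → 2 ≤ ∣ cut ⊤ χ ∣
  cut⊤≥2 χ {x} {y} χx≢χy with 2 ≤? ∣ cut ⊤ χ ∣
  ... | yes p = p
  ... | no ¬p = contradiction (2ec (cut ⊤ χ) (≤-pred (≰⇒> ¬p)) x y) (∉-cut-path χ χx≢χy)

  separated : ∀ {χ : V → Bool} {x y} → χ x ≡ true → χ y ≡ false → χ x ≢ χ y
  separated χx χy eq = true≢false (trans (sym χx) (trans eq χy))

  -- The component of `s` after deleting `e` and `f` has its boundary inside these two edges, and
  -- 2-edge-connectivity makes the boundary contain both.
  critical⇒forced : ∀ {e} → Critical (rank e) → IsForced e
  critical⇒forced {e} (f , ¬linked) = χ , reach-refl keep s , χt , size≡2 , e∈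
    where
    keep : E → Bool
    keep = avoiding (rank e) (rank f) ∘ rank
    χ : V → Bool
    χ = reach keep s
    χt : χ t ≡ false
    χt = dec-false (linked? ends keep s t) ¬linked
    ≥2 : 2 ≤ ∣ cut ⊤ χ ∣
    ≥2 = cut⊤≥2 χ (separated {χ} (reach-refl keep s) χt)
    ∈-ef : ∀ {g} → g ∈ cut ⊤ χ → g ≡ e ⊎ g ≡ f
    ∈-ef {g} g∈ = Sum.map (rank-injective g e) (rank-injective g f)
      (avoiding-false (rank e) (rank f) (reach-cut keep s {⊤} g∈))
    small : ∀ {p : EdgeSet} → (∀ {g} → g ∈ p → g ≡ f) → ∣ p ∣ ≤ 1
    small {p} ≡f = ≤-trans (p⊆q⇒∣p∣≤∣q∣ {p = p} {q = ⁅ f ⁆} (λ g∈ → subst (_∈ ⁅ f ⁆) (sym (≡f g∈)) (x∈⁅x⁆ f)))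
                           (≤-reflexive (∣⁅x⁆∣≡1 f))
    e∈ : e ∈ cut ⊤ χ
    e∈ with e ∈? cut ⊤ χ
    ... | yes p = p
    ... | no ¬p = contradiction ≥2 (<⇒≱ (s≤s (small λ g∈ →
            Sum.[ (λ g≡e → contradiction (subst (_∈ cut ⊤ χ) g≡e g∈) ¬p) , (λ g≡f → g≡f) ] (∈-ef g∈))))
    size≡2 : ∣ cut ⊤ χ ∣ ≡ 2
    size≡2 = ≤-antisym (≤-trans (∣p∣≤1+∣p-x∣ (cut ⊤ χ) e) (s≤s (small λ g∈ →
             Sum.[ (λ { refl → contradiction (x∈⁅x⁆ e) (x∈p─q⇒x∉q {p = cut ⊤ χ} g∈) }) , (λ g≡f → g≡f) ]
               (∈-ef (p─q⊆p (cut ⊤ χ) ⁅ e ⁆ g∈)))))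
           ≥2

  -- The partner `f` is an edge of the 2-cut crossed by a path from `s` to `t` that avoids `e`. A
  -- path avoiding both would cross the cut at a third edge.
  forced⇒critical : ∀ {e} → IsForced e → Critical (rank e)
  forced⇒critical {e} (χ , χs , χt , size≡2 , e∈)
    with crossing χ (path⇒connected (2ec ⁅ e ⁆ (≤-reflexive (∣⁅x⁆∣≡1 e)) s t)) (separated {χ} χs χt)
  ... | f , _ , _ , k , i , χa≢χb , _ = f , λ linked →
    let g , _ , _ , k′ , i′ , χa≢χb′ , _ = crossing χ linked (separated {χ} χs χt)
        g≢e , g≢f = avoiding-true (rank e) (rank f) k′
    in <-irrefl (sym size≡2) (three-elements e∈ (∈-cut⁺ χ ∈⊤ i χa≢χb) (∈-cut⁺ χ ∈⊤ i′ χa≢χb′)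
         (λ { refl → x∈p─q⇒x∉q {p = ⊤} {q = ⁅ e ⁆} (lookup⇒[]= f _ k) (x∈⁅x⁆ f) })
         (g≢e ∘ cong rank) (g≢f ∘ cong rank))

  uncritical-true : ∀ {e} → uncritical (rank e) ≡ true → ¬ IsForced e
  uncritical-true {e} eq forced with critical? (rank e)
  ... | no ¬c = ¬c (forced⇒critical forced)

  uncritical-false : ∀ {e} → uncritical (rank e) ≡ false → IsForced e
  uncritical-false {e} eq with critical? (rank e)
  ... | yes c = critical⇒forced c

  Terminal : V → Set
  Terminal w = w ≡ s ⊎ w ≡ t ⊎ ∃[ e ] IsForced e × (w ≡ proj₁ (ends e) ⊎ w ≡ proj₂ (ends e))

  terminals⁻ : ∀ {w} → w ∈ᴸ terminals → Terminal w
  terminals⁻ w∈ with collect⁻ ends _ _ w∈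
  ... | inj₁ (here w≡s)         = inj₁ w≡s
  ... | inj₁ (there (here w≡t)) = inj₂ (inj₁ w≡t)
  ... | inj₂ (e , c , w≡)       = inj₂ (inj₂ (e , critical⇒forced (does-true (critical? (rank e)) c) , w≡))
    where
    does-true : ∀ {P : Set} (P? : Dec P) → does P? ≡ true → P
    does-true (yes p) _ = p

  terminals⁺ : ∀ {w} → Terminal w → w ∈ᴸ terminals
  terminals⁺ (inj₁ w≡s)        = collect-base ends _ _ (here w≡s)
  terminals⁺ (inj₂ (inj₁ w≡t)) = collect-base ends _ _ (there (here w≡t))
  terminals⁺ (inj₂ (inj₂ (e , forced , w≡))) =
    collect-ends ends _ _ e (dec-true (critical? (rank e)) (forced⇒critical forced)) w≡

  terminal : ∀ {e a b} → IsForced e → Incident e a b → Terminal a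
  terminal {e} forced (inj₁ eq) = inj₂ (inj₂ (e , forced , inj₁ (sym (cong proj₁ eq))))
  terminal {e} forced (inj₂ eq) = inj₂ (inj₂ (e , forced , inj₂ (sym (cong proj₂ eq))))

  same-side : ∀ χ → χ s ≡ true → χ t ≡ false → ∣ cut ⊤ χ ∣ ≡ 2 →
              ∀ {u v} → Connected (uncritical ∘ rank) u v → χ u ≡ χ v
  same-side χ χs χt size≡2 = constant χ same
    where
    same : ∀ {e a b} → uncritical (rank e) ≡ true → Incident e a b → χ a ≡ χ b
    same {e} {a} {b} k i with χ a Bool.≟ χ b
    ... | yes p = p
    ... | no ¬p = contradiction (χ , χs , χt , size≡2 , ∈-cut⁺ χ ∈⊤ i ¬p) (uncritical-true {e} k)

  module _ {H : EdgeSet} (forced⊆H : ∀ {e} → IsForced e → e ∈ H) (feasible : Feasible I H) where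

    path-avoiding : ∀ F → ∣ F ∣ ≤ 1 → HasPath graph (H ─ F) s t
    path-avoiding F F≤1 = feasible F (m≤n⇒m≤1+n F≤1) (2ec F F≤1 s t)

    -- In the uncrossing, this bounds the part that does not separate `z` from `w`.
    cut≥2 : ∀ χ → χ s ≢ χ t → 2 ≤ ∣ cut H χ ∣
    cut≥2 χ χs≢χt with 2 ≤? ∣ cut H χ ∣
    ... | yes p = p
    ... | no ¬p = contradiction (path-avoiding (cut H χ) (≤-pred (≰⇒> ¬p))) (∉-cut-path χ χs≢χt)

    deleting : ∀ {F u v} → Connected (lookup (H ─ F)) u v → Connected (lookup H) u v
    deleting {F} = Star.map λ (e , k , i) → e , []=⇒lookup (p─q⊆p H F (lookup⇒[]= e _ k)) , i

    -- Deleting the partner of a forced edge leaves a path from s to t in H, which must use the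
    -- forced edge.

    terminal-connected : ∀ {w} → Terminal w → Connected (lookup H) s w
    terminal-connected (inj₁ refl)        = ε
    terminal-connected (inj₂ (inj₁ refl)) =
      deleting {⊥} (path⇒connected (path-avoiding ⊥ (≤-trans (≤-reflexive (∣⊥∣≡0 m)) z≤n)))
    terminal-connected {w} (inj₂ (inj₂ (e , (χ , χs , χt , size≡2 , e∈) , w≡)))
      with crossing χ (path⇒connected (path-avoiding (cut ⊤ χ - e)
             (≤-pred (subst (∣ cut ⊤ χ - e ∣ <_) size≡2 (x∈p⇒∣p-x∣<∣p∣ e∈))))) (separated {χ} χs χt)
    ... | f , a , b , k , i , χa≢χb , p = reach-end (f Fin.≟ e) (incident w≡)
      where
      F : EdgeSet
      F = cut ⊤ χ - e
      f∈ : f ∈ H ─ F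
      f∈ = lookup⇒[]= f _ k
      incident : w ≡ proj₁ (ends e) ⊎ w ≡ proj₂ (ends e) → ∃[ x ] Incident e w x
      incident (inj₁ refl) = _ , inj₁ refl
      incident (inj₂ refl) = _ , inj₂ refl
      to-end : w ≡ a ⊎ w ≡ b → Connected (lookup H) s w
      to-end (inj₁ refl) = deleting {F} p
      to-end (inj₂ refl) = deleting {F} p ◅◅ (f , []=⇒lookup (p─q⊆p H F f∈) , i) ◅ ε
      reach-end : Dec (f ≡ e) → ∃[ x ] Incident e w x → Connected (lookup H) s w
      reach-end (yes refl) (x , j) = to-end (incident-ends i j)
      -- A crossing edge other than `e` is the partner, which has been deleted.
      reach-end (no f≢e) _ =
        contradiction (x∈p∧x≢y⇒x∈p-y (∈-cut⁺ χ ∈⊤ i χa≢χb) f≢e) (x∈p─q⇒x∉q {p = H} f∈)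

    -- By feasibility δ_H(S) is also a cut δ_G(χ), so S xor χ is constant on the component of s in H.

    separating-small-cut : ∀ S → S s ≢ S t → ∣ cut H S ∣ ≤ 2 → ∀ {u v} → Terminal u → Terminal v →
                           Connected (uncritical ∘ rank) u v → S u ≡ S v
    separating-small-cut S Ss≢St small {u} {v} u∈T v∈T linked =
      -- Both terminals are connected to `s` in `H`, so `S xor χ` agrees at them; `χ` agrees because
      -- unforced edges do not cross a 2-cut; hence `S` agrees.
      xor-cancel {S u} {S v} {χ u} {χ v}
        (trans (sym (constant (λ x → S x xor χ x) agree (terminal-connected u∈T)))
               (constant (λ x → S x xor χ x) agree (terminal-connected v∈T)))
        (same-side χ χs χt size≡2 linked)
      where
      F : EdgeSet
      F = cut H S
      ¬path : ¬ HasPath graph (⊤ ─ F) s t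
      ¬path p = ∉-cut-path S Ss≢St (feasible F small p)
      keep : E → Bool
      keep = lookup (⊤ ─ F)
      χ : V → Bool
      χ = reach keep s
      χs : χ s ≡ true
      χs = reach-refl keep s
      χt : χ t ≡ false
      χt = dec-false (linked? ends keep s t) (¬path ∘ connected⇒path)
      ⊆F : cut ⊤ χ ⊆ F
      ⊆F {e} e∈ with e ∈? F
      ... | yes e∈F = e∈F
      ... | no  e∉F = contradiction
              (trans (sym ([]=⇒lookup (x∈p∧x∉q⇒x∈p─q ∈⊤ e∉F))) (reach-cut keep s {⊤} e∈)) true≢false
      ≥2 : 2 ≤ ∣ cut ⊤ χ ∣
      ≥2 = cut⊤≥2 χ (separated {χ} χs χt)
      size≡2 : ∣ cut ⊤ χ ∣ ≡ 2
      size≡2 = ≤-antisym (≤-trans (p⊆q⇒∣p∣≤∣q∣ ⊆F) small) ≥2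
      -- As `F` has at most 2 edges and the cut of `χ` at least 2, the inclusion is an equality.
      F⊆ : F ⊆ cut ⊤ χ
      F⊆ = ⊆∧∣∣≥⇒⊇ ⊆F (≤-trans small ≥2)
      agree : ∀ {e a b} → lookup H e ≡ true → Incident e a b → S a xor χ a ≡ S b xor χ b
      agree {e} {a} {b} k i = xor-agree {S a} {S b} {χ a} {χ b} to from
        where
        to : S a ≡ S b → χ a ≡ χ b
        to Sa≡Sb with χ a Bool.≟ χ b
        ... | yes p = p
        ... | no ¬p = contradiction Sa≡Sb (proj₂ (∈-cut⁻ {H} S (⊆F (∈-cut⁺ χ ∈⊤ i ¬p))) i)
        from : χ a ≡ χ b → S a ≡ S b
        from χa≡χb with S a Bool.≟ S b
        ... | yes p = p
        ... | no ¬p = contradiction χa≡χb (proj₂ (∈-cut⁻ {⊤} χ (F⊆ (∈-cut⁺ S (lookup⇒[]= e H k) i ¬p))) i)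

    -- Let Z be the side of S that avoids s and t, and χ a 2-cut through a forced edge at w ∈ Z.
    -- The parts P and U into which χ splits the complement of Z both separate s from t, and one
    -- of them separates z from w, so d(P) + d(U) ≥ 5; but e(P , U) ≤ 1, because the forced edge
    -- at w does not join P to U.

    nonseparating-small-cut : ∀ S → S s ≡ S t → ∣ cut H S ∣ ≤ 2 → ∀ {w z} → Terminal w → Terminal z →
                              Connected (uncritical ∘ rank) w z → S w ≢ S s → S z ≡ S s → Empty.⊥
    nonseparating-small-cut S Ss≡St small (inj₁ refl)        z∈T linked Sw≢Ss Sz≡Ss = Sw≢Ss refl
    nonseparating-small-cut S Ss≡St small (inj₂ (inj₁ refl)) z∈T linked Sw≢Ss Sz≡Ss = Sw≢Ss (sym Ss≡St)
    nonseparating-small-cut S Ss≡St small {w} {z} w∈T@(inj₂ (inj₂ (e , (χ , χs , χt , size≡2 , e∈) , w≡)))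
                            z∈T linked Sw≢Ss Sz≡Ss = absurd (χ z) refl
      where
      outsideZ P U : V → Bool
      outsideZ x = not (S x xor S s)
      P x = χ x ∧ outsideZ x
      U x = not (χ x) ∧ outsideZ x

      between : E → Bool
      between f = let a , b = ends f in lookup H f ∧ (χ a xor χ b) ∧ outsideZ a ∧ outsideZ b

      outsideZ-true : ∀ {x} → S x ≡ S s → outsideZ x ≡ true
      outsideZ-true {x} eq rewrite eq = cong not (Bool.xor-same (S s))

      outsideZ-w : outsideZ w ≡ false
      outsideZ-w = cong not (xor-≢ Sw≢Ss)

      P≡ : ∀ {x} → S x ≡ S s → P x ≡ χ x
      P≡ {x} eq = trans (cong (χ x ∧_) (outsideZ-true eq)) (Bool.∧-identityʳ (χ x))

      U≡ : ∀ {x} → S x ≡ S s → U x ≡ not (χ x)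
      U≡ {x} eq = trans (cong (not (χ x) ∧_) (outsideZ-true eq)) (Bool.∧-identityʳ (not (χ x)))

      Pw : P w ≡ false
      Pw = trans (cong (χ w ∧_) outsideZ-w) (Bool.∧-zeroʳ (χ w))

      Uw : U w ≡ false
      Uw = trans (cong (not (χ w) ∧_) outsideZ-w) (Bool.∧-zeroʳ (not (χ w)))

      Ps≢Pt : P s ≢ P t
      Ps≢Pt = separated {P} (trans (P≡ refl) χs) (trans (P≡ (sym Ss≡St)) χt)

      Us≢Ut : U s ≢ U t
      Us≢Ut eq = true≢false (trans (sym (trans (U≡ (sym Ss≡St)) (cong not χt)))
                                   (trans (sym eq) (trans (U≡ refl) (cong not χs))))

      between⊆ : Vec.tabulate between ⊆ cut ⊤ χ - e
      between⊆ {f} f∈ with ∧-true {lookup H f} (trans (sym (lookup∘tabulate between f)) ([]=⇒lookup f∈))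
      ... | _ , p with ∧-true {χ (proj₁ (ends f)) xor χ (proj₂ (ends f))} p
      ...   | χ≢ , q with ∧-true {outsideZ (proj₁ (ends f))} q
      ...     | out₁ , out₂ = x∈p∧x≢y⇒x∈p-y (∈-cut⁺ χ ∈⊤ (inj₁ refl) (xor-≢⁻ χ≢)) (f≢e w≡)
        where
        f≢e : w ≡ proj₁ (ends e) ⊎ w ≡ proj₂ (ends e) → f ≢ e
        f≢e (inj₁ eq) refl = true≢false (trans (sym out₁) (trans (cong outsideZ (sym eq)) outsideZ-w))
        f≢e (inj₂ eq) refl = true≢false (trans (sym out₂) (trans (cong outsideZ (sym eq)) outsideZ-w))

      between≤1 : ∣ Vec.tabulate between ∣ ≤ 1
      between≤1 = ≤-trans (p⊆q⇒∣p∣≤∣q∣ between⊆)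
        (≤-pred (subst (∣ cut ⊤ χ - e ∣ <_) size≡2 (x∈p⇒∣p-x∣<∣p∣ e∈)))

      sum≤4 : ∣ cut H P ∣ + ∣ cut H U ∣ ≤ 4
      sum≤4 = ≤-trans
        (∣∣-mono-pointwise _ _ _ between λ f →
          uncrossing (lookup H f) (χ (proj₁ (ends f))) (S (proj₁ (ends f)))
                     (χ (proj₂ (ends f))) (S (proj₂ (ends f))) (S s))
        (+-mono-≤ small (+-mono-≤ between≤1 between≤1))

      ≥3 : ∀ S → S s ≢ S t → S w ≢ S z → 3 ≤ ∣ cut H S ∣
      ≥3 S Ss≢St Sw≢Sz with 3 ≤? ∣ cut H S ∣
      ... | yes p = p
      ... | no ¬p = contradiction (separating-small-cut S Ss≢St (≤-pred (≰⇒> ¬p)) w∈T z∈T linked) Sw≢Sz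

      -- The value `χ z` tells whether `z` lies in `P` or in `U`; `w` lies in neither.
      absurd : ∀ b → χ z ≡ b → Empty.⊥
      absurd true χz = <-irrefl refl (≤-trans
        (+-mono-≤ (≥3 P Ps≢Pt (λ eq → true≢false (trans (sym (trans (P≡ Sz≡Ss) χz)) (trans (sym eq) Pw))))
                  (cut≥2 U Us≢Ut))
        sum≤4)
      absurd false χz = <-irrefl refl (≤-trans
        (+-mono-≤ (cut≥2 P Ps≢Pt)
                  (≥3 U Us≢Ut (λ eq → true≢false (trans (sym (trans (U≡ Sz≡Ss) (cong not χz))) (trans (sym eq) Uw)))))
        sum≤4)

    linked-terminals-cut : ∀ {u v} → Terminal u → Terminal v → Connected (uncritical ∘ rank) u v →
                           ∀ S → S u ≢ S v → 3 ≤ ∣ cut H S ∣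
    linked-terminals-cut {u} {v} u∈T v∈T linked S Su≢Sv with 3 ≤? ∣ cut H S ∣
    ... | yes p = p
    ... | no ¬p with S s Bool.≟ S t | S u Bool.≟ S s | S v Bool.≟ S s
    ...   | no Ss≢St  | _ | _ =
            contradiction (separating-small-cut S Ss≢St (≤-pred (≰⇒> ¬p)) u∈T v∈T linked) Su≢Sv
    ...   | yes Ss≡St | yes Su | yes Sv = contradiction (trans Su (sym Sv)) Su≢Sv
    -- Now `v` is the terminal cut off from `s` and `t`, so the two exchange roles.
    ...   | yes Ss≡St | yes Su | no Sv  = Empty.⊥-elim
            (nonseparating-small-cut S Ss≡St (≤-pred (≰⇒> ¬p)) v∈T u∈T (Linked-sym linked) Sv Su)
    ...   | yes Ss≡St | no Su  | yes Sv = Empty.⊥-elim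
            (nonseparating-small-cut S Ss≡St (≤-pred (≰⇒> ¬p)) u∈T v∈T linked Su Sv)
    ...   | yes Ss≡St | no Su  | no Sv  = contradiction
            (trans (Bool.¬-not Su) (sym (Bool.¬-not Sv))) Su≢Sv

    feasible⇒demands : All (Satisfies graph H) demands
    feasible⇒demands = All.tabulate λ { {u , v} d∈ →
      let u∈ , v∈ , u≢v , linked = allDemands⁻ terminals terminals d∈ in
      satisfies⁺ {H} u≢v (linked-terminals-cut (terminals⁻ u∈) (terminals⁻ v∈) linked) }

  -- `G` itself is a feasible solution containing all forced edges, so it satisfies the demands.
  ordinary-demands : All (IsOrdinary3Demand graph) demands
  ordinary-demands = All.tabulate λ { {u , v} d∈ →
    proj₁ (proj₂ (proj₂ (allDemands⁻ terminals terminals d∈))) ,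
    All.lookup (feasible⇒demands {⊤} (λ _ → ∈⊤) (λ _ _ p → p)) d∈ }

  -- Let A be the set of vertices reachable from s in H ∖ F.  Along a path of G ∖ F from s we keep
  -- a terminal of A that is linked to the current vertex by unforced edges; since A is a cut of
  -- size at most 2 of H, the demands keep it from splitting linked terminals.

  demands⇒feasible : ∀ {H} → (∀ {e} → IsForced e → e ∈ H) → All (Satisfies graph H) demands → Feasible I H
  demands⇒feasible {H} forced⊆H sat F F≤2 path =
    -- The walk starts with `s` as its own marker; that `t` is a terminal carries membership in `A`
    -- over to it at the end.
    connected⇒path (reach-sound (reach-terminal (inj₂ (inj₁ refl)) (walk path (s , inj₁ refl , reach-refl keep s , ε))))
    where
    keep : E → Bool
    keep = lookup (H ─ F)
    A : V → Bool
    A = reach keep s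

    reach-sound : ∀ {x} → A x ≡ true → Connected keep s x
    reach-sound {x} Ax with linked? ends keep s x
    ... | yes p = p

    cut≤2 : ∣ cut H A ∣ ≤ 2
    cut≤2 = ≤-trans (p⊆q⇒∣p∣≤∣q∣ cut⊆F) F≤2
      where
      cut⊆F : cut H A ⊆ F
      cut⊆F {e} e∈ with e ∈? F
      ... | yes e∈F = e∈F
      ... | no  e∉F = contradiction
        (trans (sym ([]=⇒lookup (x∈p∧x∉q⇒x∈p─q (proj₁ (∈-cut⁻ {H} A e∈)) e∉F))) (reach-cut keep s {H} e∈))
        true≢false

    Marked : V → Set
    Marked x = ∃[ u ] Terminal u × A u ≡ true × Connected (uncritical ∘ rank) u x

    reach-terminal : ∀ {x} → Terminal x → Marked x → A x ≡ true
    reach-terminal {x} x∈T (u , u∈T , Au , linked) with u Fin.≟ x | A x in Ax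
    ... | _        | true  = refl
    -- Demands join distinct terminals, so a marker that is the vertex itself needs its own case.
    ... | yes refl | false = trans (sym Ax) Au
    ... | no u≢x   | false = contradiction cut≤2 (<⇒≱ (satisfies⁻ {H}
          (All.lookup sat (allDemands⁺ (terminals⁺ u∈T) (terminals⁺ x∈T) (u≢x , linked))) A Au Ax))

    walk : ∀ {x y} → HasPath graph (⊤ ─ F) x y → Marked x → Marked y
    walk ε marked = marked
    walk (_◅_ {x} {y} (e , e∈ , i) p) marked@(u , u∈T , Au , linked) with uncritical (rank e) in k
    ... | true  = walk p (u , u∈T , Au , linked ◅◅ (e , k , i) ◅ ε)
    -- A forced edge outside `F` survives in `H ─ F`, so both of its ends lie in `A`, and the far
    -- end becomes the new marker.
    ... | false = walk p (y , terminal forced (Sum.swap i) ,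
        trans (sym (reach-step keep s ([]=⇒lookup e∈′) i)) (reach-terminal (terminal forced i) marked) , ε)
      where
      forced : IsForced e
      forced = uncritical-false k
      e∈′ : e ∈ H ─ F
      e∈′ = x∈p∧x∉q⇒x∈p─q (forced⊆H forced) (x∈p─q⇒x∉q {p = ⊤} e∈)

  demands-correct : ∀ H → (∀ e → Forced I e → e ∈ H) → Feasible I H ⇔ All (Satisfies graph H) demands
  demands-correct H forced⊆H = mk⇔
    (feasible⇒demands (λ {e} f → forced⊆H e (forced⁺ f)))
    (demands⇒feasible (λ {e} f → forced⊆H e (forced⁺ f)))

theorem3p1 : Σ[ P ∈ Program instanceTy vertexPairsTy ]
    (Σ[ c ∈ ℕ ] Σ[ k ∈ ℕ ]
    (∀ (I : Instance) → TwoEdgeConnected (Instance.graph I) →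
    time P (encode I) ≤ c * suc (size instanceTy (encode I)) ^ k))
    ×
    (∀ (I : Instance) → TwoEdgeConnected (Instance.graph I) →
    Σ[ D ∈ List (Instance.V I × Instance.V I) ]
    run P (encode I) ≡ map encodePair D
    × All (IsOrdinary3Demand (Instance.graph I)) D
    × (∀ (H : Instance.EdgeSet I) → (∀ e → Forced I e → e ∈ H) →
    Feasible I H ⇔ All (Satisfies (Instance.graph I) H) D))
theorem3p1 =
  program ,
  (4 ^ degree program , degree program , λ I _ → program-polynomial I) ,
  λ I 2ec → let open Instance I in
    Algorithm.demands ends s t ,
    -- The last argument here is chosen to dominate both `n` and 2 + 2m.
    SmallPrograms.eval-program ends s t (2 + (n + (m + m)))
      (≤-trans (m≤m+n n (m + m)) (m≤n+m (n + (m + m)) 2)) (+-monoʳ-≤ 2 (m≤n+m (m + m) n))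
      (tabulate (encodeWeight ∘ weight)) ,
    ordinary-demands I 2ec ,
    demands-correct I 2ec
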